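{- Let $G$ be a Berge graph, let $X\subseteq V(G)$ be anticonnected, let $C$ be a hole in $G\setminus X$ of length $>4$, and let $uv$ be an edge of $C$ such that $u,v$ are $X$-complete and no other vertex of $C$ is $X$-complete. Number the vertices of $C$ as $p_1,\dots,p_n$ in order with $p_1=u$, $p_n=v$. Then either $X$ contains a vertex adjacent to $u$ and $v$ and to no other vertex of $C$, or $X$ contains two nonadjacent vertices $a,b$ such that the neighbours of $a$ in $V(C)$ are exactly $p_1,p_2,p_n$ and the neighbours of $b$ in $V(C)$ are exactly $p_1,p_{n-1},p_n$.
   Context: Graphs are finite and simple. Hole: induced cycle of length $\ge4$; antihole: induced subgraph whose complement is a hole; Berge: all holes and antiholes have even length. $X$ is anticonnected if the complement of $G|X$ is connected; a vertex is $X$-complete if it is adjacent to every vertex of $X$. -}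

module Defs where

open import Data.Nat using (ℕ; suc; _≤_)
open import Data.Nat.Divisibility using (_∣_)
open import Data.Fin using (Fin; toℕ)
open import Data.Fin.Subset using (Subset; _∈_)
open import Data.List using (List)
import Data.List.Membership.Propositional as List
open import Data.Product using (∃; _×_; _,_; proj₁)
open import Data.Sum using (_⊎_)
open import Function.Bundles using (_⇔_)
open import Function.Definitions using (Injective)
open import Level using (0ℓ)
open import Relation.Binary.Core using (Rel)
open import Relation.Binary.Definitions using (Symmetric; Irreflexive)
open import Relation.Binary.Construct.Closure.ReflexiveTransitive using (Star)
open import Relation.Binary.PropositionalEquality using (_≡_; _≢_; refl; ≢-sym)
open import Relation.Nullary using (¬_)

record Graph (V : Set) : Set₁ where
  field
    Adj    : Rel V 0ℓ
    sym    : Symmetric Adj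
    irrefl : Irreflexive _≡_ Adj

open Graph public using (Adj)

complement : ∀ {V} → Graph V → Graph V
complement G = record
  { Adj    = λ u v → u ≢ v × ¬ Adj G u v
  ; sym    = λ (u≢v , ¬uv) → ≢-sym u≢v , λ vu → ¬uv (Graph.sym G vu)
  ; irrefl = λ u≡v (u≢v , _) → u≢v u≡v
  }

-- Proofs of v ∈ X are unique, so the vertices of induced G X are exactly
-- the elements of X.
induced : ∀ {n} → Graph (Fin n) → (X : Subset n) → Graph (∃ (_∈ X))
induced G X = record
  { Adj    = λ u v → Adj G (proj₁ u) (proj₁ v)
  ; sym    = Graph.sym G
  ; irrefl = λ { refl → Graph.irrefl G refl }
  }

-- The graph with no vertices counts as connected.
Connected : ∀ {V} → Graph V → Set
Connected G = ∀ u v → Star (Adj G) u v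

Anticonnected : ∀ {n} → Graph (Fin n) → Subset n → Set
Anticonnected G X = Connected (complement (induced G X))

-- Irreflexivity of G already excludes X-complete vertices lying in X.
Complete : ∀ {n} → Graph (Fin n) → Subset n → Fin n → Set
Complete G X v = ∀ {x} → x ∈ X → Adj G v x

CyclicSucc : ∀ {k} → Rel (Fin k) 0ℓ
CyclicSucc {k} i j =
  (toℕ j ≡ suc (toℕ i)) ⊎ (suc (toℕ i) ≡ k × toℕ j ≡ 0)

CyclicAdj : ∀ {k} → Rel (Fin k) 0ℓ
CyclicAdj i j = CyclicSucc i j ⊎ CyclicSucc j i

-- A hole of length k, given together with a numbering of its vertices in
-- cyclic order.  Each hole has 2k numberings, one for every choice of a first
-- vertex and a direction.
record Hole {V : Set} (G : Graph V) (k : ℕ) : Set where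
  field
    vertex    : Fin k → V
    length≥4  : 4 ≤ k
    injective : Injective _≡_ _≡_ vertex
    adjacency : ∀ i j → Adj G (vertex i) (vertex j) ⇔ CyclicAdj i j

open Hole public using (vertex)

-- D is an antihole of G when the complement of D, which is an induced subgraph
-- of the complement of G, is a hole there.
Antihole : ∀ {V} → Graph V → ℕ → Set
Antihole G k = Hole (complement G) k

Berge : ∀ {V} → Graph V → Set
Berge G = (∀ {k} → Hole G k → 2 ∣ k) × (∀ {k} → Antihole G k → 2 ∣ k)

-- The neighbours of x in V(C) are exactly the vertices of C at positions is.
NeighboursOn : ∀ {V k} (G : Graph V) → Hole G k → V → List (Fin k) → Set
NeighboursOn G C x is = ∀ i → Adj G x (vertex C i) ⇔ i List.∈ is

{-# OPTIONS --safe #-}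
-- The theorem is the Roussel–Rubio lemma, applied to C as a path p₁ … pₙ whose
-- ends happen to be adjacent: if no vertex of X sees only p₁ and pₙ, this
-- adjacency is harmless.  For an odd path with T-complete ends and no T-complete
-- inner vertex, T anticonnected, the lemma gives a leap in T or (for length 3) an
-- odd antipath through T between the two inner vertices.  Induction on T: for
-- smaller T′ ⊂ T, every two consecutive T′-complete vertices are adjacent or at
-- even distance, because an outcome for T′ on a proper subpath closes up to an
-- odd hole or antihole through p₁ or pₙ.  If a is not a cut vertex of the
-- complement of T, comparing the parities of the numbers of (T − a)-complete and
-- of {a}-complete edges shows that p₂ or pₙ₋₁ is (T − a)-complete.  Three non-cut
-- vertices are therefore impossible, so T is an antipath; its two ends are
-- handled by the same parity count.
module Submission where

open import Defs
open import Data.Empty using (⊥; ⊥-elim)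
open import Data.Fin using (Fin; zero; suc; toℕ; fromℕ; inject₁)
import Data.Fin.Properties as Fin
open import Data.Fin.Subset using (Subset; _∈_; _∉_; _⊆_; _⊂_; _∪_; _─_; _-_; ⁅_⁆; ∣_∣; inside; outside)
open import Data.Fin.Subset.Induction using (⊂-wellFounded; Acc; acc)
open import Data.Fin.Subset.Properties
open import Data.List using (List; []; _∷_)
import Data.List.Membership.Propositional as List
import Data.List.Membership.DecPropositional as DecList
open import Data.List.Relation.Unary.Any using (here; there)
open import Data.Nat using (ℕ; zero; suc; _+_; _∸_; _≤_; _<_; z≤n; s≤s; s≤s⁻¹; z<s; parity)
open import Data.Nat.Divisibility using (_∣_; divides)
open import Data.Nat.Properties
open import Data.Parity.Base as ℙ using (Parity; 0ℙ; 1ℙ)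
import Data.Parity.Properties as ℙ
open import Data.Product using (∃-syntax; _×_; _,_; proj₁; proj₂)
open import Data.Sum using (_⊎_; inj₁; inj₂; swap; [_,_]′)
open import Data.Vec using (_∷_; here; there)
open import Data.Vec.Properties.WithK using ([]=-irrelevant)
open import Function using (_∘_; id; case_of_)
open import Function.Bundles using (_⇔_; mk⇔; Equivalence)
open import Level using (0ℓ)
open import Relation.Binary.Construct.Closure.ReflexiveTransitive as Star using (Star; ε; _◅_; _◅◅_)
open import Relation.Binary.Core using (Rel)
open import Relation.Binary.Definitions using (Symmetric; Decidable; tri<; tri≈; tri>)
open import Relation.Binary.PropositionalEquality
open import Relation.Nullary using (¬_; Dec; yes; no; contradiction)
open import Relation.Nullary.Decidable using (_×-dec_; _⊎-dec_; _→-dec_; ¬?; map′)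

-- Counting, modulo 2, the edges between consecutive marked positions.

Odd : ℕ → Set
Odd k = parity k ≡ 1ℙ

parity-suc : ∀ k → parity (suc k) ≡ parity k ℙ.⁻¹
parity-suc k = trans (sym (ℙ.⁻¹-involutive (parity (suc k)))) (cong ℙ._⁻¹ (ℙ.suc-homo-⁻¹ k))

2∣⇒¬Odd : ∀ {k} → 2 ∣ k → ¬ Odd k
2∣⇒¬Odd (divides q refl) odd with trans (sym odd) (trans (ℙ.*-homo-* q 2) (ℙ.*-zeroʳ (parity q)))
... | ()

module Marks {M : ℕ → Set} (M? : ∀ k → Dec (M k)) where

  bit : {A : Set} → Dec A → Parity
  bit (yes _) = 1ℙ
  bit (no _)  = 0ℙ

  bit-yes : ∀ {A : Set} (A? : Dec A) → A → bit A? ≡ 1ℙ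
  bit-yes (yes _) a = refl
  bit-yes (no ¬a) a = contradiction a ¬a

  bit-no : ∀ {A : Set} (A? : Dec A) → ¬ A → bit A? ≡ 0ℙ
  bit-no (yes a) ¬a = contradiction a ¬a
  bit-no (no _)  ¬a = refl

  edgeParity : ℕ → Parity
  edgeParity zero    = 0ℙ
  edgeParity (suc k) = bit (M? k ×-dec M? (suc k)) ℙ.+ edgeParity k

  edge-exists : ∀ N → edgeParity N ≡ 1ℙ → ∃[ k ] k < N × M k × M (suc k)
  edge-exists (suc N) eq with M? N ×-dec M? (suc N)
  ... | yes (m , m′) = N , ≤-refl , m , m′
  ... | no _         = let k , k<N , rest = edge-exists N eq in k , m<n⇒m<1+n k<N , rest

-- Writing the distance as `2 + e` leaves the odd distances from 3 on, so neighbouring marks stay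
-- allowed, and `e` matches the index of a `Situation`.
OddGapFree : (ℕ → Set) → ℕ → Set
OddGapFree M N = ∀ i e → Odd e → i + (2 + e) ≤ N → M i → M (i + (2 + e)) →
  (∀ k → i < k → k < i + (2 + e) → ¬ M k) → ⊥

module _ {M : ℕ → Set} (M? : ∀ k → Dec (M k)) where

  open Marks M?

  -- The invariant: the edge count up to `k` has the parity of the last mark `g` up to `k`. A mark
  -- next to `g` adds one edge; a mark further on adds none and, by hypothesis, lies at even
  -- distance from `g`.
  last-mark : ∀ {N} → M 0 → OddGapFree M N → ∀ k → k ≤ N →
    ∃[ g ] g ≤ k × M g × (∀ j → g < j → j ≤ k → ¬ M j) × edgeParity k ≡ parity g
  last-mark m₀ free zero _ = 0 , z≤n , m₀ , (λ j 0<j j≤0 → contradiction (<-≤-trans 0<j j≤0) n≮0) , refl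
  last-mark {N} m₀ free (suc k) k<N
    with g , g≤k , m , none , eq ← last-mark m₀ free k (<⇒≤ k<N) | M? (suc k)
  ... | no ¬m′ = g , m≤n⇒m≤1+n g≤k , m , none′ ,
    trans (cong (ℙ._+ edgeParity k) (bit-no (M? k ×-dec no ¬m′) (¬m′ ∘ proj₂))) eq
    where
    none′ : ∀ j → g < j → j ≤ suc k → ¬ M j
    none′ j g<j j≤1+k with m≤n⇒m<n∨m≡n j≤1+k
    ... | inj₁ (s≤s j≤k) = none j g<j j≤k
    ... | inj₂ refl      = ¬m′
  ... | yes m′ = suc k , ≤-refl , m′ , (λ j k<j j≤k → contradiction k<j (≤⇒≯ j≤k)) , eq′
    where
    eq′ : bit (M? k ×-dec yes m′) ℙ.+ edgeParity k ≡ parity (suc k)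
    eq′ with m≤n⇒m<n∨m≡n g≤k
    ... | inj₂ refl = begin
      bit (M? k ×-dec yes m′) ℙ.+ edgeParity k  ≡⟨ cong (ℙ._+ edgeParity k) (bit-yes (M? k ×-dec yes m′) (m , m′)) ⟩
      edgeParity k ℙ.⁻¹                         ≡⟨ cong ℙ._⁻¹ eq ⟩
      parity k ℙ.⁻¹                             ≡⟨ parity-suc k ⟨
      parity (suc k)                            ∎
      where open ≡-Reasoning
    ... | inj₁ g<k with e , refl ← m≤n⇒∃[o]m+o≡n g<k = begin
      bit (M? k ×-dec yes m′) ℙ.+ edgeParity k  ≡⟨ cong (ℙ._+ edgeParity k) (bit-no (M? k ×-dec yes m′) (none k g<k ≤-refl ∘ proj₁)) ⟩
      edgeParity k                              ≡⟨ eq ⟩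
      parity g                                  ≡⟨ ℙ.+-identityʳ (parity g) ⟨
      parity g ℙ.+ 0ℙ                           ≡⟨ cong (parity g ℙ.+_) even ⟨
      parity g ℙ.+ parity e                     ≡⟨ ℙ.+-homo-+ g e ⟨
      parity (2 + (g + e))                      ∎
      where
      open ≡-Reasoning
      end : 2 + (g + e) ≡ g + (2 + e)
      end = sym (trans (+-suc g (suc e)) (cong suc (+-suc g e)))
      even : parity e ≡ 0ℙ
      even with parity e in odd
      ... | 0ℙ = refl
      ... | 1ℙ = ⊥-elim (free g e odd (subst (_≤ N) end k<N) m (subst M end m′)
                   (λ j g<j j< → none j g<j (s≤s⁻¹ (subst (j <_) (sym end) j<))))

  edgeParity-mark : ∀ {N} → M 0 → OddGapFree M N → ∀ {k} → k ≤ N → M k → edgeParity k ≡ parity k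
  edgeParity-mark m₀ free {k} k≤N m
    with g , g≤k , _ , none , eq ← last-mark m₀ free k k≤N | m≤n⇒m<n∨m≡n g≤k
  ... | inj₁ g<k  = contradiction m (none k g<k ≤-refl)
  ... | inj₂ refl = eq

-- Here distance 1 is forbidden too: such a pair could be an edge of the union that belongs to
-- neither marking. Pairs reaching 0 or `N` are exempt, since both markings will hold there.
OddMixedFree : (ℕ → Set) → (ℕ → Set) → ℕ → Set
OddMixedFree M₁ M₂ N = ∀ i d → Odd d → 0 < i → i + d < N → M₁ i → M₂ (i + d) →
  (∀ k → i < k → k < i + d → ¬ M₁ k × ¬ M₂ k) → ⊥

-- Every M₁-edge and every M₂-edge is a (M₁ ∪ M₂)-edge, and there are no others;
-- all three numbers of edges have the parity of N, so N ≡ N + N.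
two-markings : ∀ {M₁ M₂ : ℕ → Set} → (∀ k → Dec (M₁ k)) → (∀ k → Dec (M₂ k)) →
  ∀ {N} → 2 ≤ N → M₁ 0 → M₂ 0 → M₁ N → M₂ N →
  (∀ k → 0 < k → k < N → M₁ k → ¬ M₂ k) →
  OddGapFree M₁ N → OddGapFree M₂ N → OddMixedFree M₁ M₂ N → OddMixedFree M₂ M₁ N → ¬ Odd N
two-markings {M₁} {M₂} M₁? M₂? {N} 2≤N m₁⁰ m₂⁰ m₁ᴺ m₂ᴺ disjoint free₁ free₂ mixed₁₂ mixed₂₁ odd =
  absurd (trans (sym (mark U? (inj₁ m₁⁰) freeU (inj₁ m₁ᴺ)))
         (trans (sum N ≤-refl)
                (cong₂ ℙ._+_ (mark M₁? m₁⁰ free₁ m₁ᴺ) (mark M₂? m₂⁰ free₂ m₂ᴺ))))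
  where
  U : ℕ → Set
  U k = M₁ k ⊎ M₂ k
  U? : ∀ k → Dec (U k)
  U? k = M₁? k ⊎-dec M₂? k

  absurd : ¬ (1ℙ ≡ 0ℙ)
  absurd ()

  mark : ∀ {M} (M? : ∀ k → Dec (M k)) → M 0 → OddGapFree M N → M N → Marks.edgeParity M? N ≡ 1ℙ
  mark M? m₀ free m = trans (edgeParity-mark M? m₀ free ≤-refl m) odd

  pos : ∀ {i} → ¬ (M₁ i × M₂ i) → 0 < i
  pos {zero}  ¬both = contradiction (m₁⁰ , m₂⁰) ¬both
  pos {suc i} _     = s≤s z≤n

  below : ∀ {j} → j ≤ N → ¬ (M₁ j × M₂ j) → j < N
  below j≤N ¬both = ≤∧≢⇒< j≤N λ { refl → ¬both (m₁ᴺ , m₂ᴺ) }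

  -- A marking that holds at both ends of the gap already forbids it. Otherwise the ends carry one
  -- mark each, of different kinds, so neither end is 0 or `N` and a mixed hypothesis applies.
  freeU : OddGapFree U N
  freeU i e odd-e le u u′ none = go u u′ (M₁? i) (M₂? i) (M₁? j) (M₂? j)
    where
    j = i + (2 + e)
    none₁ : ∀ k → i < k → k < j → ¬ M₁ k
    none₁ k i<k k<j m = none k i<k k<j (inj₁ m)
    none₂ : ∀ k → i < k → k < j → ¬ M₂ k
    none₂ k i<k k<j m = none k i<k k<j (inj₂ m)
    go : U i → U j → Dec (M₁ i) → Dec (M₂ i) → Dec (M₁ j) → Dec (M₂ j) → ⊥
    go _ _ (yes a) _ (yes b) _ = free₁ i e odd-e le a b none₁
    go _ _ _ (yes a) _ (yes b) = free₂ i e odd-e le a b none₂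
    go _ (inj₁ b) (yes a) _ (no ¬b) _ = ¬b b
    go _ (inj₂ b) (yes a) (no ¬a₂) (no ¬b₁) _ =
      mixed₁₂ i (2 + e) odd-e (pos (¬a₂ ∘ proj₂)) (below le (¬b₁ ∘ proj₁)) a b
        (λ k l r → none₁ k l r , none₂ k l r)
    go _ (inj₂ b) (yes a) (yes a₂) (no ¬b₁) (no ¬b) = ¬b b
    go _ (inj₁ b) (no ¬a₁) (yes a) _ (no ¬b₂) =
      mixed₂₁ i (2 + e) odd-e (pos (¬a₁ ∘ proj₁)) (below le (¬b₂ ∘ proj₂)) a b
        (λ k l r → none₂ k l r , none₁ k l r)
    go _ (inj₂ b) (no ¬a₁) (yes a) _ (no ¬b) = ¬b b
    go (inj₁ a) _ (no ¬a) _ _ _ = ¬a a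
    go (inj₂ a) _ (no _) (no ¬a) _ _ = ¬a a

  module E₁ = Marks M₁?
  module E₂ = Marks M₂?
  module EU = Marks U?

  -- Since `2 ≤ N`, every edge has an end strictly between 0 and `N`, where the markings exclude
  -- each other.
  disjoint-edges : ∀ {k} → k < N → M₁ k × M₁ (suc k) → ¬ (M₂ k × M₂ (suc k))
  disjoint-edges {zero}  k<N (_ , b) (_ , b′) = disjoint 1 (s≤s z≤n) 2≤N b b′
  disjoint-edges {suc k} k<N (a , _) (a′ , _) = disjoint (suc k) (s≤s z≤n) k<N a a′

  next : ∀ k → k + 1 ≡ suc k
  next k = +-comm k 1

  empty : ∀ {A : Set} {k} j → k < j → j < k + 1 → A
  empty {k = k} j k<j j<k+1 = contradiction k<j (≤⇒≯ (s≤s⁻¹ (subst (j <_) (next k) j<k+1)))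

  no-mixed-edge : ∀ {k} → k < N → ¬ (M₁ k × M₁ (suc k)) → ¬ (M₂ k × M₂ (suc k)) → ¬ (U k × U (suc k))
  no-mixed-edge k<N ¬e₁ ¬e₂ (inj₁ a , inj₁ b) = ¬e₁ (a , b)
  no-mixed-edge k<N ¬e₁ ¬e₂ (inj₂ a , inj₂ b) = ¬e₂ (a , b)
  no-mixed-edge {k} k<N ¬e₁ ¬e₂ (inj₁ a , inj₂ b) =
    mixed₁₂ k 1 refl (pos λ (_ , a₂) → ¬e₂ (a₂ , b))
      (subst (_< N) (sym (next k)) (below k<N λ (b₁ , _) → ¬e₁ (a , b₁))) a (subst M₂ (sym (next k)) b) (λ j l r → empty j l r)
  no-mixed-edge {k} k<N ¬e₁ ¬e₂ (inj₂ a , inj₁ b) =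
    mixed₂₁ k 1 refl (pos λ (a₁ , _) → ¬e₁ (a₁ , b))
      (subst (_< N) (sym (next k)) (below k<N λ (_ , b₂) → ¬e₂ (a , b₂))) a (subst M₁ (sym (next k)) b) (λ j l r → empty j l r)

  sum : ∀ k → k ≤ N → EU.edgeParity k ≡ E₁.edgeParity k ℙ.+ E₂.edgeParity k
  sum zero    _   = refl
  sum (suc k) k<N with sum k (<⇒≤ k<N)
  ... | ih with M₁? k ×-dec M₁? (suc k) in eq₁ | M₂? k ×-dec M₂? (suc k) in eq₂
  ... | yes e₁ | yes e₂ = contradiction e₂ (disjoint-edges k<N e₁)
  ... | yes (a , b) | no _ = begin
      EU.bit (U? k ×-dec U? (suc k)) ℙ.+ EU.edgeParity k ≡⟨ cong (ℙ._+ EU.edgeParity k) (EU.bit-yes (U? k ×-dec U? (suc k)) (inj₁ a , inj₁ b)) ⟩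
      1ℙ ℙ.+ EU.edgeParity k                             ≡⟨ cong (1ℙ ℙ.+_) ih ⟩
      1ℙ ℙ.+ (E₁.edgeParity k ℙ.+ E₂.edgeParity k)       ≡⟨ ℙ.+-assoc 1ℙ (E₁.edgeParity k) (E₂.edgeParity k) ⟨
      (1ℙ ℙ.+ E₁.edgeParity k) ℙ.+ E₂.edgeParity k       ∎
      where open ≡-Reasoning
  ... | no _ | yes (a , b) = begin
      EU.bit (U? k ×-dec U? (suc k)) ℙ.+ EU.edgeParity k ≡⟨ cong (ℙ._+ EU.edgeParity k) (EU.bit-yes (U? k ×-dec U? (suc k)) (inj₂ a , inj₂ b)) ⟩
      1ℙ ℙ.+ EU.edgeParity k                             ≡⟨ cong (1ℙ ℙ.+_) (trans ih (ℙ.+-comm (E₁.edgeParity k) (E₂.edgeParity k))) ⟩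
      1ℙ ℙ.+ (E₂.edgeParity k ℙ.+ E₁.edgeParity k)       ≡⟨ ℙ.+-assoc 1ℙ (E₂.edgeParity k) (E₁.edgeParity k) ⟨
      (1ℙ ℙ.+ E₂.edgeParity k) ℙ.+ E₁.edgeParity k       ≡⟨ ℙ.+-comm (1ℙ ℙ.+ E₂.edgeParity k) (E₁.edgeParity k) ⟩
      E₁.edgeParity k ℙ.+ (1ℙ ℙ.+ E₂.edgeParity k)       ∎
      where open ≡-Reasoning
  ... | no ¬e₁ | no ¬e₂ = trans (cong (ℙ._+ EU.edgeParity k)
                            (EU.bit-no (U? k ×-dec U? (suc k)) (no-mixed-edge k<N ¬e₁ ¬e₂))) ih

-- Induced paths and antipaths, and closing them to holes and antiholes.

-- Only the vertices p 0, …, p N belong to the path.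
record Path {V : Set} (E F : Rel V 0ℓ) (p : ℕ → V) (N : ℕ) : Set where
  field
    edge : ∀ {i} → i < N → E (p i) (p (suc i))
    far  : ∀ {i j} → suc i < j → j ≤ N → F (p i) (p j)

open Path

infixr 5 _◂_
_◂_ : {V : Set} → V → (ℕ → V) → ℕ → V
(x ◂ p) zero    = x
(x ◂ p) (suc i) = p i

module _ {V : Set} {E F : Rel V 0ℓ} where

  ◂-path : ∀ {p N x} → Path E F p N → E x (p 0) → (∀ {i} → i < N → F x (p (suc i))) →
    Path E F (x ◂ p) (suc N)
  edge (◂-path P e f) {zero}  _          = e
  edge (◂-path P e f) {suc i} (s≤s i<N)  = edge P i<N
  far  (◂-path P e f) {zero}  {suc (suc j)} _ (s≤s j<N) = f j<N
  far  (◂-path P e f) {zero}  {suc zero} (s≤s ()) _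
  far  (◂-path P e f) {suc i} {suc j} (s≤s i<j) (s≤s j≤N) = far P i<j j≤N

  infix-path : ∀ {p N} i {d} → Path E F p N → i + d ≤ N → Path E F (λ k → p (i + k)) d
  edge (infix-path {p} i P le) {k} k<d =
    subst (λ j → E (p (i + k)) (p j)) (sym (+-suc i k)) (edge P (<-≤-trans (+-monoʳ-< i k<d) le))
  far (infix-path i P le) {k} {l} k<l l≤d =
    far P (subst (_< i + l) (+-suc i k) (+-monoʳ-< i k<l)) (≤-trans (+-monoʳ-≤ i l≤d) le)

  reverse-path : ∀ {p N} → Symmetric E → Symmetric F → Path E F p N → Path E F (λ k → p (N ∸ k)) N
  edge (reverse-path {p} {N} symE symF P) {k} k<N =
    symE (subst (λ j → E (p (N ∸ suc k)) (p j)) (sym (+-∸-assoc 1 k<N))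
           (edge P (∸-monoʳ-< (s≤s z≤n) k<N)))
  far (reverse-path {N = N} symE symF P) {k} {l} k<l l≤N =
    symF (far P (subst (_< N ∸ k) (+-∸-assoc 1 l≤N) (∸-monoʳ-< k<l (m≤n⇒m≤1+n l≤N))) (m∸n≤m N k))

  module _ (Γ : Graph V) (E⇒Adj : ∀ {u v} → E u v → Adj Γ u v) (F⇒¬Adj : ∀ {u v} → F u v → ¬ Adj Γ u v)
           (F⇒≢ : ∀ {u v} → F u v → u ≢ v) where

    -- The cycle consists of `c` and the `N + 1` path vertices, so its length has the parity of `N`.
    -- Taking the complement for `Γ` and non-adjacency for `E` gives antiholes.
    close : ∀ {p N c} → Path E F p N → 2 ≤ N → E c (p 0) → E c (p N) →
      (∀ {i} → suc i < N → F c (p (suc i))) → Hole Γ (2 + N)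
    close {p} {N} {c} P 2≤N e₀ eₙ f = record
      { vertex    = vertex′
      ; length≥4  = s≤s (s≤s 2≤N)
      ; injective = injective′
      ; adjacency = adjacency′
      }
      where
      q : ℕ → V
      q = c ◂ p

      vertex′ : Fin (2 + N) → V
      vertex′ i = q (toℕ i)

      Close : ℕ → ℕ → Set
      Close i j = j ≡ suc i ⊎ (suc j ≡ 2 + N × i ≡ 0)

      compare : ∀ {i j} → i < j → j ≤ suc N →
        (Close i j × Adj Γ (q i) (q j)) ⊎ (¬ Close i j × F (q i) (q j))
      compare {zero} {suc zero} _ _ = inj₁ (inj₁ refl , E⇒Adj e₀)
      compare {zero} {suc (suc j)} _ (s≤s j<N) with m≤n⇒m<n∨m≡n j<N
      ... | inj₁ 1+j<N = inj₂ ((λ { (inj₂ (refl , _)) → <-irrefl refl 1+j<N }) , f 1+j<N)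
      ... | inj₂ refl  = inj₁ (inj₂ (refl , refl) , E⇒Adj eₙ)
      compare {suc i} {suc j} (s≤s i<j) (s≤s j≤N) with m≤n⇒m<n∨m≡n i<j
      ... | inj₁ 1+i<j = inj₂ ((λ { (inj₁ refl) → <-irrefl refl 1+i<j ; (inj₂ (_ , ())) }) , far P 1+i<j j≤N)
      ... | inj₂ refl  = inj₁ (inj₁ refl , E⇒Adj (edge P j≤N))

      bound : ∀ (j : Fin (2 + N)) → toℕ j ≤ suc N
      bound j = s≤s⁻¹ (Fin.toℕ<n j)

      distinct : ∀ {i j} → toℕ i < toℕ j → vertex′ i ≢ vertex′ j
      distinct {i} {j} i<j eq with compare i<j (bound j)
      ... | inj₁ (_ , adj) = Graph.irrefl Γ eq adj
      ... | inj₂ (_ , apart) = F⇒≢ apart eq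

      injective′ : ∀ {i j} → vertex′ i ≡ vertex′ j → i ≡ j
      injective′ {i} {j} eq with <-cmp (toℕ i) (toℕ j)
      ... | tri< i<j _ _ = contradiction eq (distinct i<j)
      ... | tri≈ _ i≡j _ = Fin.toℕ-injective i≡j
      ... | tri> _ _ j<i = contradiction (sym eq) (distinct j<i)

      cyclic⇒close : ∀ {i j : Fin (2 + N)} → toℕ i < toℕ j → CyclicAdj i j → Close (toℕ i) (toℕ j)
      cyclic⇒close i<j (inj₁ (inj₁ eq)) = inj₁ eq
      cyclic⇒close i<j (inj₁ (inj₂ (_ , j≡0))) = contradiction (subst (_ <_) j≡0 i<j) n≮0
      cyclic⇒close i<j (inj₂ (inj₁ eq)) = contradiction i<j (≤⇒≯ (subst (_ ≤_) (sym eq) (n≤1+n _)))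
      cyclic⇒close i<j (inj₂ (inj₂ wrap)) = inj₂ wrap

      close⇒cyclic : ∀ {i j : Fin (2 + N)} → Close (toℕ i) (toℕ j) → CyclicAdj i j
      close⇒cyclic (inj₁ eq)   = inj₁ (inj₁ eq)
      close⇒cyclic (inj₂ wrap) = inj₂ (inj₂ wrap)

      adjacency< : ∀ {i j} → toℕ i < toℕ j → Adj Γ (vertex′ i) (vertex′ j) ⇔ CyclicAdj i j
      adjacency< {i} {j} i<j with compare i<j (bound j)
      ... | inj₁ (cl , adj)   = mk⇔ (λ _ → close⇒cyclic cl) (λ _ → adj)
      ... | inj₂ (¬cl , apart) = mk⇔ (λ adj → contradiction adj (F⇒¬Adj apart))
                                     (λ cyc → contradiction (cyclic⇒close i<j cyc) ¬cl)

      not-self : ∀ (i : Fin (2 + N)) → ¬ CyclicSucc i i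
      not-self i (inj₁ eq) = 1+n≢n (sym eq)
      not-self i (inj₂ (eq , i≡0)) with trans (sym (cong suc i≡0)) eq
      ... | ()

      adjacency′ : ∀ i j → Adj Γ (vertex′ i) (vertex′ j) ⇔ CyclicAdj i j
      adjacency′ i j with <-cmp (toℕ i) (toℕ j)
      ... | tri< i<j _ _ = adjacency< i<j
      ... | tri> _ _ j<i = mk⇔ (swap ∘ Equivalence.to (adjacency< j<i) ∘ Graph.sym Γ)
                              (Graph.sym Γ ∘ Equivalence.from (adjacency< j<i) ∘ swap)
      ... | tri≈ _ i≡j _ with Fin.toℕ-injective i≡j
      ...   | refl = mk⇔ (λ adj → contradiction adj (Graph.irrefl Γ refl))
                         λ { (inj₁ s) → contradiction s (not-self i) ; (inj₂ s) → contradiction s (not-self i) }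

-- Connected vertex sets, non-cut vertices and induced paths.

x∈p─q⇒x∉q : ∀ {n} {x : Fin n} (p q : Subset n) → x ∈ p ─ q → x ∉ q
x∈p─q⇒x∉q (_ ∷ p) (outside ∷ q) (there x∈) (there x∈q) = x∈p─q⇒x∉q p q x∈ x∈q
x∈p─q⇒x∉q (_ ∷ p) (inside  ∷ q) (there x∈) (there x∈q) = x∈p─q⇒x∉q p q x∈ x∈q

x∈p-y⇒x∈p : ∀ {n} {x y : Fin n} (p : Subset n) → x ∈ p - y → x ∈ p
x∈p-y⇒x∈p {y = y} p = p─q⊆p p ⁅ y ⁆

x∈p-y⇒x≢y : ∀ {n} {x y : Fin n} (p : Subset n) → x ∈ p - y → x ≢ y
x∈p-y⇒x≢y {y = y} p x∈ refl = x∈p─q⇒x∉q p ⁅ y ⁆ x∈ (x∈⁅x⁆ y)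

greatest : ∀ {P : ℕ → Set} → (∀ k → Dec (P k)) → ∀ N → P 0 →
  ∃[ g ] g ≤ N × P g × (∀ {j} → g < j → j ≤ N → ¬ P j)
greatest P? zero    p₀ = 0 , z≤n , p₀ , λ 0<j j≤0 → contradiction (<-≤-trans 0<j j≤0) n≮0
greatest P? (suc N) p₀ with P? (suc N)
... | yes p = suc N , ≤-refl , p , λ l r → contradiction l (≤⇒≯ r)
... | no ¬p with g , g≤N , p , none ← greatest P? N p₀ = g , m≤n⇒m≤1+n g≤N , p , none′
  where
  none′ : ∀ {j} → g < j → j ≤ suc N → ¬ _
  none′ l r with m≤n⇒m<n∨m≡n r
  ... | inj₁ (s≤s j≤N) = none l j≤N
  ... | inj₂ refl      = ¬p

module Connectivity {n} (E F : Rel (Fin n) 0ℓ) (E-sym : Symmetric E) (E? : Decidable E)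
                    (apart : ∀ {u v} → u ≢ v → ¬ E u v → F u v) where

  Within : Subset n → Rel (Fin n) 0ℓ
  Within T u v = u ∈ T × v ∈ T × E u v

  record ConnectedSet (T : Subset n) : Set where
    field walk : ∀ {u v} → u ∈ T → v ∈ T → Star (Within T) u v

  open ConnectedSet public

  private variable
    T K : Subset n
    x y u v : Fin n

  within-mono : K ⊆ T → Star (Within K) u v → Star (Within T) u v
  within-mono K⊆T = Star.map λ (u∈ , v∈ , e) → K⊆T u∈ , K⊆T v∈ , e

  crossing : Star (Within T) u v → u ∈ K → v ∉ K → ∃[ x ] ∃[ y ] x ∈ K × y ∈ T × y ∉ K × E x y
  crossing ε u∈K v∉K = contradiction u∈K v∉K
  crossing {K = K} (_◅_ {j = w} (_ , w∈T , e) s) u∈K v∉K with w ∈? K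
  ... | yes w∈K = crossing s w∈K v∉K
  ... | no  w∉K = _ , w , u∈K , w∈T , w∉K , e

  singleton-connected : ∀ x → ConnectedSet ⁅ x ⁆
  walk (singleton-connected x) u∈ v∈ rewrite x∈⁅y⁆⇒x≡y x u∈ | x∈⁅y⁆⇒x≡y x v∈ = ε

  ∪-connected : ConnectedSet K → x ∈ K → E x y → ConnectedSet (K ∪ ⁅ y ⁆)
  walk (∪-connected {K} {x} {y} conn x∈K e) u∈ v∈ =
    Star.reverse (λ (u∈ , v∈ , e) → v∈ , u∈ , E-sym e) (from-x u∈) ◅◅ from-x v∈
    where
    K⊆ : K ⊆ K ∪ ⁅ y ⁆
    K⊆ = p⊆p∪q ⁅ y ⁆
    from-x : ∀ {w} → w ∈ K ∪ ⁅ y ⁆ → Star (Within (K ∪ ⁅ y ⁆)) x w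
    from-x w∈ with x∈p∪q⁻ K ⁅ y ⁆ w∈
    ... | inj₁ w∈K = within-mono K⊆ (walk conn x∈K w∈K)
    ... | inj₂ w∈y with refl ← x∈⁅y⁆⇒x≡y y w∈y = (K⊆ x∈K , w∈ , e) ◅ ε

  -- Grow K inside T, one vertex at a time; the last vertex to be added is not a cut vertex.
  noncut-outside : ConnectedSet T → K ⊆ T → ConnectedSet K → x ∈ K → y ∈ T → y ∉ K →
    ∃[ c ] c ∈ T × c ∉ K × ConnectedSet (T - c)
  noncut-outside {T} connT K⊆T connK x∈K y∈T y∉K = grow n (m≤m+n n _) K⊆T connK x∈K y∈T y∉K
    where
    grow : ∀ {K x y} m → n ≤ m + ∣ K ∣ → K ⊆ T → ConnectedSet K → x ∈ K → y ∈ T → y ∉ K →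
      ∃[ c ] c ∈ T × c ∉ K × ConnectedSet (T - c)
    grow {K} m fuel K⊆T connK x∈K y∈T y∉K
      with v , w , v∈K , w∈T , w∉K , e ← crossing (walk connT (K⊆T x∈K) y∈T) x∈K y∉K
      with Fin.any? (λ z → (z ∈? T) ×-dec ¬? (z ∈? (K ∪ ⁅ w ⁆)))
    ... | no none = w , w∈T , w∉K , record { walk = λ u∈ v∈ → within-mono K⊆T-w (walk connK (T-w⊆K u∈) (T-w⊆K v∈)) }
      where
      K⊆T-w : K ⊆ T - w
      K⊆T-w z∈K = x∈p∧x≢y⇒x∈p-y (K⊆T z∈K) λ { refl → w∉K z∈K }
      T-w⊆K : T - w ⊆ K
      T-w⊆K {z} z∈ with z ∈? (K ∪ ⁅ w ⁆)
      ... | no z∉ = contradiction (z , x∈p-y⇒x∈p T z∈ , z∉) none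
      ... | yes z∈K∪w = [ id , (λ z∈w → contradiction (x∈⁅y⁆⇒x≡y w z∈w) (x∈p-y⇒x≢y T z∈)) ]′ (x∈p∪q⁻ K ⁅ w ⁆ z∈K∪w)
    ... | yes (z , z∈T , z∉) = next m fuel
      where
      larger : ∣ K ∣ < ∣ K ∪ ⁅ w ⁆ ∣
      larger = p⊂q⇒∣p∣<∣q∣ (p⊆p∪q ⁅ w ⁆ , w , q⊆p∪q K ⁅ w ⁆ (x∈⁅x⁆ w) , w∉K)
      K∪w⊆T : K ∪ ⁅ w ⁆ ⊆ T
      K∪w⊆T z∈ with x∈p∪q⁻ K ⁅ w ⁆ z∈
      ... | inj₁ z∈K = K⊆T z∈K
      ... | inj₂ z∈w with refl ← x∈⁅y⁆⇒x≡y w z∈w = w∈T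
      -- `K` gains a vertex in every round while `m` drops by one; at `m = 0` the enlarged `K` would
      -- have more than `n` elements.
      next : ∀ m → n ≤ m + ∣ K ∣ → _
      next zero fuel = contradiction (≤-trans larger (∣p∣≤n (K ∪ ⁅ w ⁆))) (≤⇒≯ fuel)
      next (suc m) fuel
        with c , c∈T , c∉ , conn ← grow m (≤-trans fuel (subst (_≤ m + ∣ K ∪ ⁅ w ⁆ ∣) (+-suc m ∣ K ∣) (+-monoʳ-≤ m larger)))
               K∪w⊆T (∪-connected connK v∈K e) (p⊆p∪q ⁅ w ⁆ x∈K) z∈T z∉
        = c , c∈T , c∉ ∘ p⊆p∪q ⁅ w ⁆ , conn

  vertexSet : (ℕ → Fin n) → ℕ → Subset n
  vertexSet q zero    = ⁅ q 0 ⁆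
  vertexSet q (suc k) = vertexSet q k ∪ ⁅ q (suc k) ⁆

  ∈-vertexSet⁺ : ∀ q {i k} → i ≤ k → q i ∈ vertexSet q k
  ∈-vertexSet⁺ q {k = zero} z≤n = x∈⁅x⁆ (q 0)
  ∈-vertexSet⁺ q {k = suc k} i≤ with m≤n⇒m<n∨m≡n i≤
  ... | inj₁ (s≤s i≤k) = p⊆p∪q ⁅ q (suc k) ⁆ (∈-vertexSet⁺ q i≤k)
  ... | inj₂ refl      = q⊆p∪q (vertexSet q k) ⁅ q (suc k) ⁆ (x∈⁅x⁆ (q (suc k)))

  ∈-vertexSet⁻ : ∀ q k → x ∈ vertexSet q k → ∃[ i ] i ≤ k × x ≡ q i
  ∈-vertexSet⁻ q zero x∈ = 0 , z≤n , x∈⁅y⁆⇒x≡y (q 0) x∈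
  ∈-vertexSet⁻ q (suc k) x∈ with x∈p∪q⁻ (vertexSet q k) ⁅ q (suc k) ⁆ x∈
  ... | inj₂ x∈ = suc k , ≤-refl , x∈⁅y⁆⇒x≡y (q (suc k)) x∈
  ... | inj₁ x∈ with i , i≤k , eq ← ∈-vertexSet⁻ q k x∈ = i , m≤n⇒m≤1+n i≤k , eq

  vertexSet-connected : ∀ {q N} → Path E F q N → ∀ {k} → k ≤ N → ConnectedSet (vertexSet q k)
  vertexSet-connected {q} P {zero}  _   = singleton-connected (q 0)
  vertexSet-connected {q} P {suc k} k<N =
    ∪-connected (vertexSet-connected P (<⇒≤ k<N)) (∈-vertexSet⁺ q ≤-refl) (edge P k<N)

  -- Induction on the walk: in the induced path found for the rest, let `g` be the last position
  -- equal or `E`-related to `u`. Dropping everything before `g`, and prepending `u` if it is not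
  -- `q g` itself, keeps the path induced.
  shorten : Star (Within T) u v → u ∈ T →
    ∃[ N ] ∃[ q ] Path E F q N × q 0 ≡ u × q N ≡ v × (∀ {i} → i ≤ N → q i ∈ T)
  shorten {u = u} ε u∈T = 0 , (λ _ → u) , record { edge = λ () ; far = λ { () z≤n } } , refl , refl , λ _ → u∈T
  shorten {u = u} ((_ , w∈T , e) ◅ s) u∈T
    with N , q , P , refl , refl , inT ← shorten s w∈T
    with greatest (λ i → E? u (q i) ⊎-dec (u Fin.≟ q i)) N (inj₁ e)
  ... | g , g≤N , inj₂ refl , none =
    N ∸ g , (λ k → q (g + k)) , infix-path g P (≤-reflexive (m+[n∸m]≡n g≤N)) , cong q (+-identityʳ g) ,
    cong q (m+[n∸m]≡n g≤N) , λ {i} i≤ → inT (≤-trans (+-monoʳ-≤ g i≤) (≤-reflexive (m+[n∸m]≡n g≤N)))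
  ... | g , g≤N , inj₁ e′ , none =
    suc (N ∸ g) , u ◂ (λ k → q (g + k)) ,
    ◂-path (infix-path g P (≤-reflexive (m+[n∸m]≡n g≤N))) (subst (E u ∘ q) (sym (+-identityʳ g)) e′)
      (λ i< → let l = m<m+n g (s≤s z≤n); r = ≤-trans (+-monoʳ-≤ g i<) (≤-reflexive (m+[n∸m]≡n g≤N)) in
        apart (none l r ∘ inj₂) (none l r ∘ inj₁)) ,
    refl , cong q (m+[n∸m]≡n g≤N) , inT′
    where
    inT′ : ∀ {i} → i ≤ suc (N ∸ g) → (u ◂ (λ k → q (g + k))) i ∈ _
    inT′ {zero}  _        = u∈T
    inT′ {suc i} (s≤s i≤) = inT (≤-trans (+-monoʳ-≤ g i≤) (≤-reflexive (m+[n∸m]≡n g≤N)))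

  record Spanning (T : Subset n) (q : ℕ → Fin n) (N : ℕ) : Set where
    field
      path    : Path E F q N
      members : ∀ {i} → i ≤ N → q i ∈ T
      covers  : ∀ {x} → x ∈ T → ∃[ i ] i ≤ N × x ≡ q i

  data Shape (T : Subset n) : Set where
    three-noncuts : ∀ {a b c} → a ≢ b → a ≢ c → b ≢ c → a ∈ T → b ∈ T → c ∈ T →
      ConnectedSet (T - a) → ConnectedSet (T - b) → ConnectedSet (T - c) → Shape T
    spanning-path : ∀ {q N} → Spanning T q (suc N) →
      ConnectedSet (T - q 0) → ConnectedSet (T - q (suc N)) → Shape T

  -- Growing from `x` gives a non-cut vertex `a`, growing from `a` another one `b`. An induced path
  -- from `a` to `b` either covers `T` or can itself be grown, which gives a third non-cut vertex.
  shape : ConnectedSet T → x ∈ T → y ∈ T → x ≢ y → Shape T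
  shape {T} {x} connT x∈T y∈T x≢y
    with a , a∈T , a∉x , connA ← noncut-outside connT (λ z∈ → subst (_∈ T) (sym (x∈⁅y⁆⇒x≡y x z∈)) x∈T)
           (singleton-connected x) (x∈⁅x⁆ x) y∈T (λ y∈ → x≢y (sym (x∈⁅y⁆⇒x≡y x y∈)))
    with b , b∈T , b∉a , connB ← noncut-outside connT (λ z∈ → subst (_∈ T) (sym (x∈⁅y⁆⇒x≡y a z∈)) a∈T)
           (singleton-connected a) (x∈⁅x⁆ a) x∈T (λ x∈ → a∉x (subst (_∈ ⁅ x ⁆) (x∈⁅y⁆⇒x≡y a x∈) (x∈⁅x⁆ x)))
    with shorten (walk connT a∈T b∈T) a∈T
  ... | zero , q , P , refl , refl , inT = contradiction (x∈⁅x⁆ (q 0)) b∉a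
  ... | suc N , q , P , refl , refl , inT
    with Fin.any? (λ z → (z ∈? T) ×-dec ¬? (z ∈? vertexSet q (suc N)))
  ... | yes (z , z∈T , z∉) =
    let c , c∈T , c∉ , connC = noncut-outside connT Q⊆T (vertexSet-connected P ≤-refl) (∈-vertexSet⁺ q {k = suc N} z≤n) z∈T z∉
    in three-noncuts (λ a≡b → b∉a (subst (_∈ ⁅ q 0 ⁆) a≡b (x∈⁅x⁆ (q 0))))
         (λ a≡c → c∉ (subst (_∈ vertexSet q (suc N)) a≡c (∈-vertexSet⁺ q {k = suc N} z≤n)))
         (λ b≡c → c∉ (subst (_∈ vertexSet q (suc N)) b≡c (∈-vertexSet⁺ q {k = suc N} ≤-refl)))
         a∈T b∈T c∈T connA connB connC
    where
    Q⊆T : vertexSet q (suc N) ⊆ T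
    Q⊆T w∈ with i , i≤ , refl ← ∈-vertexSet⁻ q (suc N) w∈ = inT i≤
  ... | no none = spanning-path (record { path = P ; members = inT ; covers = covers′ }) connA connB
    where
    covers′ : ∀ {w} → w ∈ T → ∃[ i ] i ≤ suc N × w ≡ q i
    covers′ {w} w∈T with w ∈? vertexSet q (suc N)
    ... | yes w∈ = ∈-vertexSet⁻ q (suc N) w∈
    ... | no w∉  = contradiction (w , w∈T , w∉) none

-- The Roussel-Rubio lemma: setting and outcomes.

module RousselRubio {n} (G : Graph (Fin n)) (_~?_ : Decidable (Adj G)) (berge : Berge G) where

  infix 4 _~_ _≁_ _≁?_

  _~_ : Rel (Fin n) 0ℓ
  _~_ = Adj G

  _≁_ : Rel (Fin n) 0ℓ
  _≁_ = Adj (complement G)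

  private variable
    T : Subset n
    a c t u v z : Fin n
    p : ℕ → Fin n
    N e : ℕ

  ~-sym : u ~ v → v ~ u
  ~-sym = Graph.sym G

  ≁-sym : u ≁ v → v ≁ u
  ≁-sym = Graph.sym (complement G)

  ~⇒≢ : u ~ v → u ≢ v
  ~⇒≢ u~v u≡v = Graph.irrefl G u≡v u~v

  _≁?_ : Decidable _≁_
  u ≁? v = ¬? (u Fin.≟ v) ×-dec ¬? (u ~? v)

  ≢∧¬≁⇒~ : u ≢ v → ¬ u ≁ v → u ~ v
  ≢∧¬≁⇒~ {u} {v} u≢v ¬u≁v with u ~? v
  ... | yes u~v = u~v
  ... | no ¬u~v = contradiction (u≢v , ¬u~v) ¬u≁v

  -- With non-adjacency as first relation, `ConnectedSet` means anticonnected and the paths are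
  -- antipaths.
  open Connectivity _≁_ _~_ ≁-sym _≁?_ ≢∧¬≁⇒~ public

  no-odd-hole : Path _~_ _≁_ p N → Odd N → 2 ≤ N → c ~ p 0 → c ~ p N →
    (∀ {i} → suc i < N → c ≁ p (suc i)) → ⊥
  no-odd-hole P odd 2≤N c~p₀ c~pₙ far =
    2∣⇒¬Odd (proj₁ berge (close G id proj₂ proj₁ P 2≤N c~p₀ c~pₙ far)) odd

  no-odd-antihole : Path _≁_ _~_ p N → Odd N → 2 ≤ N → c ≁ p 0 → c ≁ p N →
    (∀ {i} → suc i < N → c ~ p (suc i)) → ⊥
  no-odd-antihole P odd 2≤N c≁p₀ c≁pₙ far =
    2∣⇒¬Odd (proj₂ berge (close (complement G) id (λ u~v (_ , ¬u~v) → ¬u~v u~v) ~⇒≢ P 2≤N c≁p₀ c≁pₙ far)) odd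

  AllAdj : Subset n → Fin n → Set
  AllAdj T v = ∀ {x} → x ∈ T → v ~ x

  AllAdj? : ∀ T v → Dec (AllAdj T v)
  AllAdj? T v with Fin.all? (λ x → (x ∈? T) →-dec (v ~? x))
  ... | yes all = yes λ {x} → all x
  ... | no ¬all = no λ all → ¬all λ x → all {x}

  AllAdj⇒∉ : AllAdj T v → v ∉ T
  AllAdj⇒∉ all v∈T = ~⇒≢ (all v∈T) refl

  -- The path is p 0, …, p (2 + e), of odd length; its ends may be adjacent
  -- to each other if it has length at least 5.
  record Situation (T : Subset n) (p : ℕ → Fin n) (e : ℕ) : Set where
    field
      odd   : Odd e
      steps : ∀ {i} → i < 2 + e → p i ~ p (suc i)
      apart : ∀ {i j} → suc i < j → j ≤ 2 + e → 0 < i ⊎ j < 2 + e → p i ≁ p j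
      avoid : ∀ {i} → i ≤ 2 + e → p i ∉ T
      start : AllAdj T (p 0)
      end   : AllAdj T (p (2 + e))
      inner : ∀ {i} → i ≤ e → ¬ AllAdj T (p (suc i))
      ends  : p 0 ≁ p (2 + e) ⊎
              (2 ≤ e × (∀ {t} → t ∈ T → ¬ (∀ {i} → i ≤ e → t ≁ p (suc i))))

  -- In a leap, `c`, `p 1`, ..., `p (1 + e)`, `d` is an induced path. In the other case `p 1`,
  -- `q 0`, ..., `q K`, `p 2` is an antipath of odd length between the inner vertices of a path of
  -- length 3.
  data Outcome (T : Subset n) (p : ℕ → Fin n) (e : ℕ) : Set where
    leap : ∀ {c d} → c ∈ T → d ∈ T → c ≁ d →
      c ~ p 1 → (∀ {i} → i < e → c ≁ p (2 + i)) →
      d ~ p (1 + e) → (∀ {i} → i < e → d ≁ p (1 + i)) → Outcome T p e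
    antipath : ∀ {q K} → e ≡ 1 → Path _≁_ _~_ q K → Odd K → (∀ {i} → i ≤ K → q i ∈ T) →
      p 1 ≁ q 0 → (∀ {i} → i < K → p 1 ~ q (suc i)) →
      p 2 ≁ q K → (∀ {i} → i < K → p 2 ~ q i) → Outcome T p e

  Outcome-mono : ∀ {T′} → T′ ⊆ T → Outcome T′ p e → Outcome T p e
  Outcome-mono T′⊆T (leap c∈ d∈ cd c₁ c₂ d₁ d₂) = leap (T′⊆T c∈) (T′⊆T d∈) cd c₁ c₂ d₁ d₂
  Outcome-mono T′⊆T (antipath e≡1 Q odd q∈ a b c d) = antipath e≡1 Q odd (T′⊆T ∘ q∈) a b c d

  path⇒Situation : Odd e → Path _~_ _≁_ p (2 + e) → (∀ {i} → i ≤ 2 + e → p i ∉ T) →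
    AllAdj T (p 0) → AllAdj T (p (2 + e)) → (∀ {i} → i ≤ e → ¬ AllAdj T (p (suc i))) → Situation T p e
  path⇒Situation {e = suc e} odd P avoid start end inner = record
    { odd = odd ; steps = edge P ; apart = λ l r _ → far P l r ; avoid = avoid
    ; start = λ {x} → start {x} ; end = λ {x} → end {x} ; inner = inner
    ; ends = inj₁ (far P (s≤s z<s) ≤-refl) }

  -- A leap would give the odd hole `z`, `c`, `p 1`, ..., `p (1 + e)`, `d`, an antipath the odd
  -- antihole `z`, `p 1`, `q 0`, ..., `q K`, `p 2`.
  no-outcome : Odd e → Path _~_ _≁_ (p ∘ suc) e → AllAdj T z → (∀ {i} → i ≤ e → z ≁ p (suc i)) →
    ¬ Outcome T p e
  no-outcome {e} odd P z~ z≁ (leap {c} {d} c∈ d∈ c≁d c~ c≁ d~ d≁) =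
    no-odd-hole (◂-path (◂-path P c~ c≁) (z~ c∈) λ i< → z≁ (s≤s⁻¹ i<)) odd (s≤s (s≤s z≤n)) (~-sym (z~ d∈)) d~
      λ { {zero} _ → ≁-sym c≁d ; {suc i} (s≤s (s≤s i<e)) → d≁ i<e }
  no-outcome odd P z~ z≁ (antipath {K = K} refl Q oddK q∈ p₁≁ p₁~ p₂≁ p₂~) =
    no-odd-antihole (◂-path (◂-path Q p₁≁ p₁~) (z≁ z≤n) λ i< → z~ (q∈ (s≤s⁻¹ i<))) oddK (s≤s (s≤s z≤n))
      (≁-sym (z≁ ≤-refl)) p₂≁
      λ { {zero} _ → ~-sym (edge P ≤-refl) ; {suc i} (s≤s (s≤s i<K)) → p₂~ i<K }

  AllAdj-insert : AllAdj (T - a) v → v ~ a → AllAdj T v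
  AllAdj-insert {a = a} all v~a {x} x∈T with x Fin.≟ a
  ... | yes refl = v~a
  ... | no x≢a   = all (x∈p∧x≢y⇒x∈p-y x∈T x≢a)

  -- The induction step: a situation for `T` without an outcome.

  module Step (T : Subset n) (conn : ConnectedSet T) (p : ℕ → Fin n) (e : ℕ) (S : Situation T p e)
              (¬outcome : ¬ Outcome T p e)
              (ih : ∀ {T′} → T′ ⊂ T → ConnectedSet T′ → ∀ {p e} → Situation T′ p e → ¬ ¬ Outcome T′ p e) where

    open Situation S

    -- Only the pair `p 0`, `p (2 + e)` can spoil inducedness, so it is enough to miss one of the
    -- two.
    segment : ∀ i {d} → i + d ≤ 2 + e → 0 < i ⊎ i + d < 2 + e → Path _~_ _≁_ (λ k → p (i + k)) d
    edge (segment i le proper) {k} k<d =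
      subst (λ j → p (i + k) ~ p j) (sym (+-suc i k)) (steps (<-≤-trans (+-monoʳ-< i k<d) le))
    far (segment i le proper) {k} {l} k<l l≤d =
      apart (subst (_< i + l) (+-suc i k) (+-monoʳ-< i k<l)) (≤-trans (+-monoʳ-≤ i l≤d) le)
        ([ (λ 0<i → inj₁ (<-≤-trans 0<i (m≤m+n i k))) , (λ lt → inj₂ (≤-<-trans (+-monoʳ-≤ i l≤d) lt)) ]′ proper)

    first≁ : ∀ {j} → 1 < j → j < 2 + e → p 0 ≁ p j
    first≁ 1<j j< = apart 1<j (<⇒≤ j<) (inj₂ j<)

    last≁ : ∀ {j} → 0 < j → j ≤ e → p (2 + e) ≁ p j
    last≁ 0<j j≤e = ≁-sym (apart (s≤s (s≤s j≤e)) ≤-refl (inj₁ 0<j))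

    inner′ : ∀ {k} → 0 < k → k < 2 + e → ¬ AllAdj T (p k)
    inner′ {suc k} _ (s≤s (s≤s k≤e)) = inner k≤e

    -- The stretch across such a gap is a situation for `T′`. If it is the whole path, an outcome
    -- for `T′` is one for `T`; otherwise `p 0` or `p (2 + e)` sees none of its inner vertices and
    -- `no-outcome` applies.
    gap-free : ∀ {T′} → T′ ⊂ T → ConnectedSet T′ → OddGapFree (AllAdj T′ ∘ p) (2 + e)
    gap-free {T′} T′⊂T connT′ = free
      where
      T′⊆T : T′ ⊆ T
      T′⊆T = proj₁ T′⊂T

      proper : ∀ i e′ → Odd e′ → i + (2 + e′) ≤ 2 + e → AllAdj T′ (p i) → AllAdj T′ (p (i + (2 + e′))) →
        (∀ k → i < k → k < i + (2 + e′) → ¬ AllAdj T′ (p k)) →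
        0 < i ⊎ i + (2 + e′) < 2 + e → AllAdj T′ z → (∀ {k} → k ≤ e′ → z ≁ p (i + suc k)) → ⊥
      proper i e′ odd′ le m m′ none prop z~ z≁ =
        ih T′⊂T connT′ (path⇒Situation odd′ P (λ l → avoid (≤-trans (+-monoʳ-≤ i l) le) ∘ T′⊆T)
                         (subst (AllAdj T′ ∘ p) (sym (+-identityʳ i)) (λ {x} → m {x})) m′
                         (λ l → none _ (m<m+n i z<s) (+-monoʳ-< i (s≤s (s≤s l)))))
          (no-outcome odd′ P′ z~ z≁)
        where
        P = segment i le prop
        P′ : Path _~_ _≁_ (λ k → p (i + suc k)) e′
        P′ = infix-path 1 P (n≤1+n _)

      free : OddGapFree (AllAdj T′ ∘ p) (2 + e)
      free (suc i) e′ odd′ le m m′ none =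
        proper (suc i) e′ odd′ le m m′ none (inj₁ z<s) (λ x∈ → start (T′⊆T x∈))
          λ {k} k≤ → first≁ (s≤s (≤-trans z<s (m≤n+m (suc k) i))) (<-≤-trans (+-monoʳ-< (suc i) (s≤s (s≤s k≤))) le)
      free zero e′ odd′ (s≤s (s≤s le)) m m′ none with m≤n⇒m<n∨m≡n le
      ... | inj₁ e′<e = proper zero e′ odd′ (s≤s (s≤s le)) m m′ none (inj₂ (s≤s (s≤s e′<e))) (λ x∈ → end (T′⊆T x∈))
          λ k≤ → last≁ z<s (≤-trans (s≤s k≤) e′<e)
      ... | inj₂ refl = ih T′⊂T connT′ (record
          { odd = odd ; steps = steps ; apart = apart ; avoid = λ l → avoid l ∘ T′⊆T
          ; start = λ x∈ → start (T′⊆T x∈) ; end = λ x∈ → end (T′⊆T x∈)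
          ; inner = λ l → none _ z<s (s≤s (s≤s l))
          ; ends = [ inj₁ , (λ (2≤e , hat) → inj₂ (2≤e , λ {t} t∈ → hat (T′⊆T t∈))) ]′ ends })
          (¬outcome ∘ Outcome-mono T′⊆T)

    -- The only vertex `t` sees both ends of the path and no inner vertex, so it closes an odd hole
    -- if the ends are non-adjacent, and otherwise contradicts the second alternative of `ends`.
    singleton-case : (∀ {x y} → x ∈ T → y ∈ T → x ≡ y) → t ∈ T → ⊥
    singleton-case {t} unique t∈T =
      [ (λ p₀≁pₙ → no-odd-hole (whole p₀≁pₙ) odd (s≤s (s≤s z≤n)) (~-sym (start t∈T)) (~-sym (end t∈T))
                     λ { (s≤s (s≤s i≤e)) → t≁ i≤e })
      , (λ (_ , ¬hat) → ¬hat t∈T t≁) ]′ ends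
      where
      t≁ : ∀ {i} → i ≤ e → t ≁ p (suc i)
      t≁ i≤e = (λ { refl → avoid (s≤s (m≤n⇒m≤1+n i≤e)) t∈T }) ,
               λ t~p → inner i≤e λ x∈ → subst (_ ~_) (unique t∈T x∈) (~-sym t~p)
      whole : p 0 ≁ p (2 + e) → Path _~_ _≁_ p (2 + e)
      edge (whole _) = steps
      far (whole p₀≁pₙ) {zero} l r with m≤n⇒m<n∨m≡n r
      ... | inj₁ lt   = apart l r (inj₂ lt)
      ... | inj₂ refl = p₀≁pₙ
      far (whole _) {suc i} l r = apart l r (inj₁ z<s)

    inner-type : ∀ {a k} → a ∈ T → 0 < k → k < 2 + e → AllAdj (T - a) (p k) → p k ≁ a
    inner-type a∈T 0<k k< m = (λ { refl → avoid (<⇒≤ k<) a∈T }) , λ pk~a → inner′ 0<k k< (AllAdj-insert m pk~a)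

    -- Deleting a vertex `a` that leaves `T` anticonnected.

    module Leaf {a b} (a∈T : a ∈ T) (b∈T : b ∈ T) (a≢b : a ≢ b) (connA : ConnectedSet (T - a)) where

      T-a⊂T : T - a ⊂ T
      T-a⊂T = x∈p⇒p-x⊂p a∈T

      T-a⊆T : T - a ⊆ T
      T-a⊆T = proj₁ T-a⊂T

      -- `T` is anticonnected with a second vertex `b`, so `a` has a non-neighbour in `T - a`.
      a-incomplete : ¬ AllAdj (T - a) a
      a-incomplete all
        with x , y , x∈ , y∈T , y∉ , x≁y ← crossing {K = ⁅ a ⁆} (walk conn a∈T b∈T) (x∈⁅x⁆ a) (x≢y⇒x∉⁅y⁆ (a≢b ∘ sym))
        with refl ← x∈⁅y⁆⇒x≡y a x∈
        = proj₂ x≁y (all (x∈p∧x≢y⇒x∈p-y y∈T (x∉⁅y⁆⇒x≢y y∉)))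

      -- The argument is an application of the induction hypothesis to the path z a r 0 … r d,
      -- the vertex y being used to close the hole or antihole that the outcome gives.
      mixed-pair : ∀ {r d y z} → Odd d → Path _~_ _≁_ r d → (∀ {i} → i ≤ d → r i ∉ T) →
        r 0 ~ a → (∀ {i} → i < d → r (suc i) ≁ a) →
        AllAdj (T - a) (r d) → (∀ {i} → i < d → ¬ AllAdj (T - a) (r i)) →
        AllAdj T z → (∀ {i} → i ≤ d → z ≁ r i) →
        AllAdj (T - a) y → y ≁ a → (∀ {i} → i < d → y ≁ r i) → ⊥
      mixed-pair {r} {suc d} {y} {z} odd-d R r∉T r₀~a r≁a r-end r-inner z~ z≁ y~ y≁a y≁ =
        ih T-a⊂T connA
          (path⇒Situation odd-d
            (◂-path (◂-path R (~-sym r₀~a) (≁-sym ∘ r≁a)) (z~ a∈T) (λ i< → z≁ (s≤s⁻¹ i<)))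
            avoid′ (λ x∈ → z~ (T-a⊆T x∈)) r-end inner″)
          closed
        where
        avoid′ : ∀ {i} → i ≤ 3 + d → (z ◂ a ◂ r) i ∉ T - a
        avoid′ {zero}        _ = AllAdj⇒∉ (λ x∈ → z~ (T-a⊆T x∈))
        avoid′ {suc zero}    _ = λ a∈ → x∈p-y⇒x≢y T a∈ refl
        avoid′ {suc (suc i)} (s≤s (s≤s i≤)) = r∉T i≤ ∘ T-a⊆T
        inner″ : ∀ {i} → i ≤ suc d → ¬ AllAdj (T - a) ((a ◂ r) i)
        inner″ {zero}  _  = a-incomplete
        inner″ {suc i} i< = r-inner i<
        closed : ¬ Outcome (T - a) (z ◂ a ◂ r) (suc d)
        -- The hole is `f`, `y`, `c`, `a`, `r 0`, ..., `r d`; the last vertex `r (suc d)` of the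
        -- path is left out.
        closed (leap {c} {f} c∈ f∈ c≁f c~ c≁ f~ f≁) =
          no-odd-hole
            (◂-path {x = y}
              (◂-path {x = c} (◂-path {x = a} (infix-path 0 R (n≤1+n d)) (~-sym r₀~a) (λ i< → ≁-sym (r≁a (m<n⇒m<1+n i<))))
                c~ c≁)
              (y~ c∈) λ { {zero} _ → y≁a ; {suc i} (s≤s i<) → y≁ i< })
            odd-d (s≤s (s≤s z≤n)) (~-sym (y~ f∈)) f~
            λ { {zero} _ → ≁-sym c≁f ; {suc zero} _ → f≁ z<s ; {suc (suc i)} (s≤s (s≤s (s≤s i<))) → f≁ (s≤s i<) }
        closed (antipath {K = K} refl Q oddK q∈ a≁q a~q r≁q r~q) =
          no-odd-antihole
            (◂-path {x = y} (◂-path Q a≁q a~q) y≁a (λ i< → y~ (q∈ (s≤s⁻¹ i<))))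
            oddK (s≤s (s≤s z≤n)) (≁-sym (y≁ z<s)) r≁q
            λ { {zero} _ → r₀~a ; {suc i} (s≤s (s≤s i<)) → r~q i< }

      -- If both fail, mark the vertices complete to `T - a` and those adjacent to `a`. No inner
      -- vertex has both marks, `gap-free` controls each marking and `mixed-pair` the mixed gaps, so
      -- `two-markings` contradicts the odd length.
      leaf : AllAdj (T - a) (p 1) ⊎ AllAdj (T - a) (p (1 + e))
      leaf with AllAdj? (T - a) (p 1) | AllAdj? (T - a) (p (1 + e))
      ... | yes m | _     = inj₁ λ {x} → m {x}
      ... | no _  | yes m = inj₂ λ {x} → m {x}
      ... | no ¬m₁ | no ¬m₂ = ⊥-elim (two-markings M₁? M₂? (s≤s (s≤s z≤n)) (λ x∈ → start (T-a⊆T x∈)) (a∈⇒ (start a∈T))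
              (λ x∈ → end (T-a⊆T x∈)) (a∈⇒ (end a∈T)) disjoint free₁ (gap-free a⊂T (singleton-connected a)) mixed₁₂ mixed₂₁ odd)
        where
        M₁ M₂ : ℕ → Set
        M₁ k = AllAdj (T - a) (p k)
        M₂ k = AllAdj ⁅ a ⁆ (p k)
        M₁? : ∀ k → Dec (M₁ k)
        M₁? k = AllAdj? (T - a) (p k)
        M₂? : ∀ k → Dec (M₂ k)
        M₂? k = AllAdj? ⁅ a ⁆ (p k)

        a∈⇒ : ∀ {v} → v ~ a → AllAdj ⁅ a ⁆ v
        a∈⇒ v~a x∈ = subst (_ ~_) (sym (x∈⁅y⁆⇒x≡y a x∈)) v~a

        a⊂T : ⁅ a ⁆ ⊂ T
        a⊂T = (λ x∈ → subst (_∈ T) (sym (x∈⁅y⁆⇒x≡y a x∈)) a∈T) , b , b∈T , x≢y⇒x∉⁅y⁆ (a≢b ∘ sym)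

        free₁ : OddGapFree M₁ (2 + e)
        free₁ = gap-free T-a⊂T connA

        disjoint : ∀ k → 0 < k → k < 2 + e → M₁ k → ¬ M₂ k
        disjoint k 0<k k< m₁ m₂ = inner′ 0<k k< (AllAdj-insert m₁ (m₂ (x∈⁅x⁆ a)))

        ¬M₂⇒≁ : ∀ {k} → k ≤ 2 + e → ¬ M₂ k → p k ≁ a
        ¬M₂⇒≁ k≤ ¬m = (λ { refl → avoid k≤ a∈T }) , λ pk~a → ¬m (a∈⇒ pk~a)

        -- An odd number of `M₁`-edges is not zero, and as `p 1` and `p (1 + e)` are not in `M₁`,
        -- the edge found avoids both ends of the path. One of its vertices will be the `y` of
        -- `mixed-pair`.
        M₁-edge : ∃[ k ] 0 < k × suc k < 2 + e × M₁ k × M₁ (suc k)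
        M₁-edge with Marks.edge-exists M₁? (2 + e)
                     (trans (edgeParity-mark M₁? (λ x∈ → start (T-a⊆T x∈)) free₁ ≤-refl (λ x∈ → end (T-a⊆T x∈))) odd)
        ... | zero  , _  , _ , m′ = contradiction (λ {x} → m′ {x}) ¬m₁
        ... | suc k , k< , m , m′ = suc k , z<s , ≤∧≢⇒< k< (λ { refl → ¬m₂ m }) , (λ {x} → m {x}) , (λ {x} → m′ {x})

        -- The stretch is read backwards, to start at the neighbour of `a`. Since `p 1` is not in
        -- `M₁`, `1 < i`, so `p 0` can serve as `z`.
        mixed₁₂ : OddMixedFree M₁ M₂ (2 + e)
        mixed₁₂ i d odd-d 0<i i+d< m₁ m₂ none =
          case M₁-edge of λ (k , 0<k , k+1< , m , m′) → far-edge k 0<k k+1< m m′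
          where
          1<i : 1 < i
          1<i = ≤∧≢⇒< 0<i λ { refl → ¬m₁ m₁ }
          r : ℕ → Fin n
          r j = p (i + (d ∸ j))
          inside< : ∀ {j} → j < d → i < i + (d ∸ j)
          inside< j<d = m<m+n i (m<n⇒0<n∸m j<d)
          le : ∀ j → i + (d ∸ j) ≤ i + d
          le j = +-monoʳ-≤ i (m∸n≤m d j)
          r≁ : ∀ {j} → j < d → r (suc j) ≁ a
          r≁ {j} j<d with m≤n⇒m<n∨m≡n j<d
          ... | inj₁ j+1<d = ¬M₂⇒≁ (≤-trans (le (suc j)) (<⇒≤ i+d<))
                  (proj₂ (none (i + (d ∸ suc j)) (inside< j+1<d) (+-monoʳ-< i (∸-monoʳ-< z<s j<d))))
          ... | inj₂ refl = subst (λ h → p h ≁ a) (sym (trans (cong (i +_) (n∸n≡0 d)) (+-identityʳ i)))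
                  (inner-type a∈T 0<i (≤-<-trans (m≤m+n i d) i+d<) m₁)
          r-inner : ∀ {j} → j < d → ¬ M₁ (i + (d ∸ j))
          r-inner {zero} 0<d m = disjoint (i + d) (<-≤-trans 0<i (m≤m+n i d)) i+d< m m₂
          r-inner {suc j} j<d = proj₁ (none (i + (d ∸ suc j)) (inside< j<d) (+-monoʳ-< i (∸-monoʳ-< z<s (<⇒≤ j<d))))
          use : ∀ {y} → AllAdj (T - a) y → y ≁ a → (∀ {j} → i < j → j ≤ i + d → y ≁ p j) → ⊥
          use y~ y≁a y≁ = mixed-pair odd-d
            (reverse-path ~-sym ≁-sym (segment i (<⇒≤ i+d<) (inj₁ 0<i)))
            (λ {j} _ → avoid (≤-trans (le j) (<⇒≤ i+d<)))
            (m₂ (x∈⁅x⁆ a)) r≁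
            (subst M₁ (sym (trans (cong (i +_) (n∸n≡0 d)) (+-identityʳ i))) (λ {x} → m₁ {x})) r-inner
            start (λ {j} _ → first≁ (<-≤-trans 1<i (m≤m+n i (d ∸ j))) (≤-<-trans (le j) i+d<))
            y~ y≁a (λ {j} j<d → y≁ (inside< j<d) (le j))
          -- An edge starting before `p i` supplies its left end as `y`, one starting after
          -- `p (i + d)` its right end; then a vertex lies between `y` and all that `y` must miss.
          -- Any other position contradicts `none` or `disjoint`.
          far-edge : ∀ k → 0 < k → suc k < 2 + e → M₁ k → M₁ (suc k) → ⊥
          far-edge k 0<k k+1< m m′ with k <? i
          ... | yes k<i = use m (inner-type a∈T 0<k (<⇒≤ k+1<) m)
                            λ l r → apart (≤-<-trans k<i l) (<⇒≤ (≤-<-trans r i+d<)) (inj₁ 0<k)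
          ... | no k≮i with <-cmp k (i + d)
          ...   | tri≈ _ refl _ = disjoint (i + d) 0<k i+d< m m₂
          ...   | tri> _ _ i+d<k = use m′ (inner-type a∈T z<s k+1< m′)
                            λ l r → ≁-sym (apart (s≤s (≤-<-trans r i+d<k)) (<⇒≤ k+1<) (inj₁ (≤-<-trans z≤n l)))
          ...   | tri< k<i+d _ _ with m≤n⇒m<n∨m≡n k<i+d
          ...     | inj₁ k+1<i+d = proj₁ (none (suc k) (s≤s (≮⇒≥ k≮i)) k+1<i+d) m′
          ...     | inj₂ eq = disjoint (suc k) z<s k+1< m′ (subst M₂ (sym eq) (λ {x} → m₂ {x}))

        -- The mirror image, read forwards: `p (2 + e)` serves as `z`, because `p (1 + e)` is not in
        -- `M₁`.
        mixed₂₁ : OddMixedFree M₂ M₁ (2 + e)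
        mixed₂₁ i d odd-d 0<i i+d< m₂ m₁ none =
          case M₁-edge of λ (k , 0<k , k+1< , m , m′) → far-edge k 0<k k+1< m m′
          where
          i+d≤e : i + d ≤ e
          i+d≤e = s≤s⁻¹ (≤∧≢⇒< (s≤s⁻¹ i+d<) λ eq → ¬m₂ (subst M₁ eq (λ {x} → m₁ {x})))
          0<i+ : ∀ j → 0 < i + j
          0<i+ j = <-≤-trans 0<i (m≤m+n i j)
          at-start : ∀ {k} → i ≡ k → M₁ k → ⊥
          at-start refl m = disjoint i 0<i (≤-<-trans (m≤m+n i d) i+d<) m m₂
          r≁ : ∀ {j} → j < d → p (i + suc j) ≁ a
          r≁ {j} j<d with m≤n⇒m<n∨m≡n j<d
          ... | inj₁ j+1<d = ¬M₂⇒≁ (≤-trans (+-monoʳ-≤ i j<d) (<⇒≤ i+d<)) (proj₁ (none (i + suc j) (m<m+n i z<s) (+-monoʳ-< i j+1<d)))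
          ... | inj₂ refl = inner-type a∈T (0<i+ d) i+d< m₁
          r-inner : ∀ {j} → j < d → ¬ M₁ (i + j)
          r-inner {zero} 0<d = at-start (sym (+-identityʳ i))
          r-inner {suc j} j<d = proj₂ (none (i + suc j) (m<m+n i z<s) (+-monoʳ-< i j<d))
          use : ∀ {y} → AllAdj (T - a) y → y ≁ a → (∀ {j} → i ≤ j → j < i + d → y ≁ p j) → ⊥
          use y~ y≁a y≁ = mixed-pair odd-d (segment i (<⇒≤ i+d<) (inj₁ 0<i))
            (λ j≤d → avoid (≤-trans (+-monoʳ-≤ i j≤d) (<⇒≤ i+d<)))
            (subst (λ h → p h ~ a) (sym (+-identityʳ i)) (m₂ (x∈⁅x⁆ a))) r≁ m₁ r-inner
            end (λ {j} j≤d → last≁ (0<i+ j) (≤-trans (+-monoʳ-≤ i j≤d) i+d≤e))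
            y~ y≁a (λ {j} j<d → y≁ (m≤m+n i j) (+-monoʳ-< i j<d))
          far-edge : ∀ k → 0 < k → suc k < 2 + e → M₁ k → M₁ (suc k) → ⊥
          far-edge k 0<k k+1< m m′ with i + d ≤? k
          ... | yes i+d≤k = use m′ (inner-type a∈T z<s k+1< m′)
                  λ l r → ≁-sym (apart (s≤s (<-≤-trans r i+d≤k)) (<⇒≤ k+1<) (inj₁ (<-≤-trans 0<i l)))
          ... | no i+d≰k with <-cmp i k
          ...   | tri≈ _ eq _ = at-start eq m
          ...   | tri< i<k _ _ = proj₂ (none k i<k (≰⇒> i+d≰k)) m
          ...   | tri> _ _ k<i with m≤n⇒m<n∨m≡n k<i
          ...     | inj₂ eq = at-start (sym eq) m′
          ...     | inj₁ k+1<i = use m (inner-type a∈T 0<k (<⇒≤ k+1<) m)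
                  λ l r → apart (<-≤-trans k+1<i l) (<⇒≤ (<-trans r i+d<)) (inj₁ 0<k)

    -- Combining several non-cut vertices.

    clash : ∀ {a b v} → a ≢ b → AllAdj (T - a) v → AllAdj (T - b) v → AllAdj T v
    clash {a} a≢b allA allB {x} x∈T with x Fin.≟ a
    ... | yes refl = allB (x∈p∧x≢y⇒x∈p-y x∈T a≢b)
    ... | no x≢a   = allA (x∈p∧x≢y⇒x∈p-y x∈T x≢a)

    no-clash : ∀ {a b k} → a ≢ b → 0 < k → k < 2 + e → AllAdj (T - a) (p k) → ¬ AllAdj (T - b) (p k)
    no-clash a≢b 0<k k< allA allB = inner′ 0<k k< (clash a≢b allA allB)

    second : ∀ {a b} → a ≢ b → AllAdj (T - a) (p 1) → ¬ AllAdj (T - b) (p 1)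
    second a≢b = no-clash a≢b z<s (s≤s z<s)

    penultimate : ∀ {a b} → a ≢ b → AllAdj (T - a) (p (1 + e)) → ¬ AllAdj (T - b) (p (1 + e))
    penultimate a≢b = no-clash a≢b z<s ≤-refl

    -- By `leaf` each of the three chooses `p 1` or `p (1 + e)`; two choose the same vertex, which
    -- would then be complete to `T`.
    three-leaves : ∀ {a b c} → a ≢ b → a ≢ c → b ≢ c → a ∈ T → b ∈ T → c ∈ T →
      ConnectedSet (T - a) → ConnectedSet (T - b) → ConnectedSet (T - c) → ⊥
    three-leaves a≢b a≢c b≢c a∈T b∈T c∈T connA connB connC
      with Leaf.leaf a∈T b∈T a≢b connA | Leaf.leaf b∈T a∈T (a≢b ∘ sym) connB | Leaf.leaf c∈T a∈T (a≢c ∘ sym) connC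
    ... | inj₁ x | inj₁ y | _      = second a≢b x y
    ... | inj₁ x | inj₂ y | inj₁ z = second a≢c x z
    ... | inj₁ x | inj₂ y | inj₂ z = penultimate b≢c y z
    ... | inj₂ x | inj₂ y | _      = penultimate a≢b x y
    ... | inj₂ x | inj₁ y | inj₁ z = second b≢c y z
    ... | inj₂ x | inj₁ y | inj₂ z = penultimate a≢c x z

    -- The case that `T` is the vertex set of an antipath.

    module Antipath {q L} (1≤L : 1 ≤ L) (Q : Spanning T q L) where

      open Spanning Q renaming (path to Qpath)

      distinct : ∀ {i j} → i < j → j ≤ L → q i ≢ q j
      distinct i<j j≤L with m≤n⇒m<n∨m≡n i<j
      ... | inj₁ i+1<j = ~⇒≢ (far Qpath i+1<j j≤L)
      ... | inj₂ refl  = proj₁ (edge Qpath j≤L)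

      head∈T : q 0 ∈ T
      head∈T = members z≤n

      tail∈T : q L ∈ T
      tail∈T = members ≤-refl

      head-type : ∀ {v} → (∀ {i} → i < L → v ~ q (suc i)) → AllAdj (T - q 0) v
      head-type v~ x∈ with covers (x∈p-y⇒x∈p T x∈)
      ... | zero  , _   , refl = contradiction refl (x∈p-y⇒x≢y T x∈)
      ... | suc i , i<L , refl = v~ i<L

      tail-type : ∀ {v} → (∀ {i} → i < L → v ~ q i) → AllAdj (T - q L) v
      tail-type v~ x∈ with covers (x∈p-y⇒x∈p T x∈)
      ... | i , i≤L , refl with m≤n⇒m<n∨m≡n i≤L
      ...   | inj₁ i<L  = v~ i<L
      ...   | inj₂ refl = contradiction refl (x∈p-y⇒x≢y T x∈)

      head-~ : ∀ {v i} → AllAdj (T - q 0) v → i < L → v ~ q (suc i)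
      head-~ all i<L = all (x∈p∧x≢y⇒x∈p-y (members i<L) (distinct z<s i<L ∘ sym))

      tail-~ : ∀ {v i} → AllAdj (T - q L) v → i < L → v ~ q i
      tail-~ all i<L = all (x∈p∧x≢y⇒x∈p-y (members (<⇒≤ i<L)) (distinct i<L ≤-refl))

      -- In the sequence `p 1`, `q 0`, ..., `q L`, `p (1 + e)` consecutive vertices are non-adjacent
      -- and all other pairs adjacent, except perhaps its two ends. For odd `L` and `e = 1` this is
      -- the excluded outcome; for even `L` and larger `e` it is an antihole of length `L + 3`.
      opposite : e ≡ 1 ⊎ ¬ Odd L → AllAdj (T - q 0) (p 1) → AllAdj (T - q L) (p (1 + e)) → ⊥
      opposite cases allH allT = go (parity L) refl e refl cases
        where
        p₁≁ : p 1 ≁ q 0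
        p₁≁ = inner-type head∈T z<s (s≤s z<s) allH
        p₂≁ : p (1 + e) ≁ q L
        p₂≁ = inner-type tail∈T z<s ≤-refl allT
        P₁ : Path _≁_ _~_ (p 1 ◂ q) (suc L)
        P₁ = ◂-path Qpath p₁≁ (head-~ allH)
        go : ∀ π → parity L ≡ π → ∀ e′ → e′ ≡ e → e ≡ 1 ⊎ ¬ Odd L → ⊥
        go 1ℙ oddL _ _ (inj₂ ¬oddL) = ¬oddL oddL
        go 1ℙ oddL _ _ (inj₁ refl) =
          ¬outcome (antipath refl Qpath oddL members p₁≁ (head-~ allH) p₂≁ (tail-~ allT))
        go 0ℙ evenL zero refl _ = case odd of λ ()
        -- The antihole is `p 2`, `p 0`, `p 3`, `p 1`, `q 0`, ..., `q L`, of length `L + 5`. As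
        -- `e = 1`, the first alternative of `ends` must hold, so `p 0` and `p 3` are non-adjacent.
        go 0ℙ evenL (suc zero) refl _ =
          no-odd-antihole (◂-path (◂-path P₁ p₃≁p₁ p₃~) p₀≁p₃ p₀~) odd-1+L (s≤s (s≤s z≤n))
            (≁-sym (apart (s≤s z<s) (n≤1+n 2) (inj₂ ≤-refl))) p₂≁
            λ { {zero} _ → steps ≤-refl ; {suc zero} _ → ~-sym (steps (s≤s z<s))
              ; {suc (suc i)} (s≤s (s≤s (s≤s i<L))) → tail-~ allT i<L }
          where
          odd-1+L : parity (1 + L) ≡ 1ℙ
          odd-1+L = trans (parity-suc L) (cong ℙ._⁻¹ evenL)
          p₀≁p₃ : p 0 ≁ p 3
          p₀≁p₃ with ends
          ... | inj₁ p₀≁p₃        = p₀≁p₃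
          ... | inj₂ (s≤s () , _)
          p₃≁p₁ : p 3 ≁ p 1
          p₃≁p₁ = ≁-sym (apart ≤-refl ≤-refl (inj₁ z<s))
          p₃~ : ∀ {i} → i < suc L → p 3 ~ q i
          p₃~ i< = end (members (s≤s⁻¹ i<))
          p₀~ : ∀ {i} → i < 2 + L → p 0 ~ (p 1 ◂ q) i
          p₀~ {zero}  _       = steps z<s
          p₀~ {suc i} (s≤s i<) = start (members (s≤s⁻¹ i<))
        go 0ℙ evenL (suc (suc e′)) refl _ =
          no-odd-antihole P₁ (trans (parity-suc L) (cong ℙ._⁻¹ evenL)) (s≤s 1≤L)
            (≁-sym (apart (s≤s (s≤s z<s)) (n≤1+n _) (inj₁ z<s))) p₂≁
            λ { (s≤s i<L) → tail-~ allT i<L }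

      -- `p 0` serves unless the stretch starts at `p 1`, and `p (2 + e)` unless it stops at
      -- `p (1 + e)`; the exception is the whole interior.
      off-segment : ∀ {i d} → 0 < i → i + d < 2 + e →
        (∃[ z ] AllAdj T z × (∀ {k} → k ≤ d → z ≁ p (i + k))) ⊎ (i ≡ 1 × i + d ≡ 1 + e)
      off-segment {suc (suc i)} {d} _ i+d< = inj₁ (p 0 , (λ {x} → start {x}) , λ {k} k≤d →
        first≁ (s≤s z<s) (≤-<-trans (s≤s (s≤s (+-monoʳ-≤ i k≤d))) i+d<))
      off-segment {suc zero} {d} _ (s≤s (s≤s d≤e)) with m≤n⇒m<n∨m≡n d≤e
      ... | inj₁ d<e = inj₁ (p (2 + e) , (λ {x} → end {x}) , λ k≤d → last≁ z<s (≤-trans (s≤s k≤d) d<e))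
      ... | inj₂ refl = inj₂ (refl , refl)

      mixed : 2 ≤ e → Odd L → OddMixedFree (λ k → AllAdj (T - q 0) (p k)) (λ k → AllAdj (T - q L) (p k)) (2 + e)
      mixed 2≤e oddL i zero ()
      mixed 2≤e oddL i (suc zero) _ 0<i i+1< mH mT none with off-segment {i} {1} 0<i i+1<
      ... | inj₂ (refl , refl) = contradiction 2≤e λ { (s≤s ()) }
      -- The antihole is `z`, `p i`, `q 0`, ..., `q L`, `p (i + 1)`, of length `L + 4`.
      ... | inj₁ (z , z~ , z≁) =
        no-odd-antihole (◂-path {x = z} (◂-path Qpath (inner-type head∈T 0<i i< mH) (head-~ mH))
                          (subst (λ k → z ≁ p k) (+-identityʳ i) (z≁ z≤n)) λ j< → z~ (members (s≤s⁻¹ j<)))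
          oddL (s≤s (s≤s z≤n)) (≁-sym (z≁ ≤-refl))
          (inner-type tail∈T (<-≤-trans 0<i (m≤m+n i 1)) i+1< mT)
          λ { {zero} _ → ~-sym (subst (λ k → p i ~ p k) (+-comm 1 i) (steps i<))
            ; {suc j} (s≤s (s≤s j<L)) → tail-~ mT j<L }
        where
        i< : i < 2 + e
        i< = ≤-<-trans (m≤m+n i 1) i+1<
      mixed 2≤e oddL i (suc (suc f)) odd-f 0<i i+d< mH mT none = go L refl
        where
        d = suc (suc f)
        i< : i < 2 + e
        i< = ≤-<-trans (m≤m+n i d) i+d<
        pi≁head : p i ≁ q 0
        pi≁head = inner-type head∈T 0<i i< mH
        pj≁tail : p (i + d) ≁ q L
        pj≁tail = inner-type tail∈T (<-≤-trans 0<i (m≤m+n i d)) i+d< mT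
        nonadj : ∀ {k t} → t ∈ T → k ≤ 2 + e → ¬ p k ~ t → p k ≁ t
        nonadj t∈T k≤ ¬pk~t = (λ { refl → avoid k≤ t∈T }) , ¬pk~t
        go : ∀ L′ → L′ ≡ L → ⊥
        go zero refl = contradiction 1≤L λ ()
        -- `T` is the pair `q 0`, `q 1`, and no vertex strictly inside the stretch sees either. If
        -- the stretch is the whole interior, the pair is a leap; otherwise `z`, `q 1`, `p i`, ...,
        -- `p (i + d)`, `q 0` is an odd hole.
        go (suc zero) refl = short
          where
          between : ∀ {k} → i < k → k < i + d → p k ≁ q 0 × p k ≁ q 1
          between {k} l r =
            nonadj head∈T k≤ (λ pk~a → proj₂ (none k l r) (tail-type λ { {zero} _ → pk~a ; {suc _} (s≤s ()) })) ,
            nonadj tail∈T k≤ (λ pk~b → proj₁ (none k l r) (head-type λ { {zero} _ → pk~b ; {suc _} (s≤s ()) }))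
            where
            k≤ : k ≤ 2 + e
            k≤ = <⇒≤ (<-trans r i+d<)
          b≁ : ∀ {k} → i < k → k ≤ i + d → q 1 ≁ p k
          b≁ l r with m≤n⇒m<n∨m≡n r
          ... | inj₁ r′   = ≁-sym (proj₂ (between l r′))
          ... | inj₂ refl = ≁-sym pj≁tail
          a≁ : ∀ {k} → i ≤ k → k < i + d → q 0 ≁ p k
          a≁ l r with m≤n⇒m<n∨m≡n l
          ... | inj₁ l′   = ≁-sym (proj₁ (between l′ r))
          ... | inj₂ refl = ≁-sym pi≁head
          short : ⊥
          short with off-segment {i} {d} 0<i i+d<
          ... | inj₂ (refl , refl) =
            ¬outcome (leap tail∈T head∈T (≁-sym (edge Qpath z<s))
              (~-sym (head-~ mH z<s)) (λ i<e → b≁ (s≤s z<s) (s≤s i<e))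
              (~-sym (tail-~ mT z<s)) (λ i<e → a≁ (s≤s z≤n) (s≤s i<e)))
          ... | inj₁ (z , z~ , z≁) =
            no-odd-hole
              (◂-path {x = z}
                (◂-path {x = q 1} (segment i (<⇒≤ i+d<) (inj₁ 0<i))
                  (subst (λ k → q 1 ~ p k) (sym (+-identityʳ i)) (~-sym (head-~ mH z<s)))
                  λ {k} k<d → b≁ (m<m+n i z<s) (+-monoʳ-≤ i k<d))
                (z~ tail∈T) λ k< → z≁ (s≤s⁻¹ k<))
              odd-f (s≤s (s≤s z≤n)) (~-sym (z~ head∈T)) (~-sym (tail-~ mT z<s))
              λ { {zero} _ → edge Qpath z<s
                ; {suc k} (s≤s (s≤s k<d)) → a≁ (m≤m+n i k) (+-monoʳ-< i k<d) }
        -- Both ends of the stretch are complete to the interior `Q°` of the antipath. A vertex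
        -- between them that is so too contradicts `none` if it sees an end of `q`, and closes `q`
        -- to an odd antihole if not. Hence `gap-free` for `Q°` is violated.
        go (suc (suc ℓ)) refl =
          gap-free (Q°⊆T , q 0 , head∈T , head∉Q°) (vertexSet-connected (infix-path 1 Qpath (n≤1+n _)) ≤-refl)
            i f odd-f (<⇒≤ i+d<) (on-Q° λ j≤ → head-~ mH (s≤s (m≤n⇒m≤1+n j≤))) (on-Q° λ j≤ → tail-~ mT (s≤s (s≤s j≤)))
            no-Q°
          where
          Q° : Subset n
          Q° = vertexSet (q ∘ suc) ℓ
          Q°⊆T : Q° ⊆ T
          Q°⊆T x∈ with j , j≤ℓ , refl ← ∈-vertexSet⁻ (q ∘ suc) ℓ x∈ = members (s≤s (m≤n⇒m≤1+n j≤ℓ))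
          head∉Q° : q 0 ∉ Q°
          head∉Q° q₀∈ with j , j≤ℓ , eq ← ∈-vertexSet⁻ (q ∘ suc) ℓ q₀∈ = distinct z<s (s≤s (m≤n⇒m≤1+n j≤ℓ)) eq
          on-Q° : ∀ {v} → (∀ {j} → j ≤ ℓ → v ~ q (suc j)) → AllAdj Q° v
          on-Q° v~ x∈ with j , j≤ℓ , refl ← ∈-vertexSet⁻ (q ∘ suc) ℓ x∈ = v~ j≤ℓ
          no-Q° : ∀ k → i < k → k < i + d → ¬ AllAdj Q° (p k)
          no-Q° k l r all with p k ~? q 0 | p k ~? q (2 + ℓ)
          ... | yes pk~a | _ = proj₂ (none k l r) (tail-type λ
                  { {zero} _ → pk~a ; {suc j} (s≤s (s≤s j≤)) → all (∈-vertexSet⁺ (q ∘ suc) j≤) })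
          ... | no _ | yes pk~b = proj₁ (none k l r) (head-type tail-or-Q°)
            where
            tail-or-Q° : ∀ {j} → j < 2 + ℓ → p k ~ q (suc j)
            tail-or-Q° (s≤s j≤) with m≤n⇒m<n∨m≡n j≤
            ... | inj₁ (s≤s j≤ℓ) = all (∈-vertexSet⁺ (q ∘ suc) j≤ℓ)
            ... | inj₂ refl      = pk~b
          ... | no ¬pk~a | no ¬pk~b =
            no-odd-antihole Qpath oddL (s≤s (s≤s z≤n)) (nonadj head∈T k≤ ¬pk~a) (nonadj tail∈T k≤ ¬pk~b)
              λ { (s≤s (s≤s j≤ℓ)) → all (∈-vertexSet⁺ (q ∘ suc) j≤ℓ) }
            where
            k≤ : k ≤ 2 + e
            k≤ = <⇒≤ (<-trans r i+d<)

    reverse-spanning : ∀ {q L} → Spanning T q L → Spanning T (λ k → q (L ∸ k)) L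
    reverse-spanning {q} {L} Q = record
      { path    = reverse-path ≁-sym ~-sym path
      ; members = λ {i} _ → members (m∸n≤m L i)
      ; covers  = λ x∈ → let i , i≤L , eq = covers x∈ in L ∸ i , m∸n≤m L i , trans eq (cong q (sym (m∸[m∸n]≡n i≤L)))
      }
      where open Spanning Q

    -- If `e = 1` or the antipath has even length, `leaf` at its two ends chooses one vertex twice,
    -- a clash, or two different ones, excluded by `opposite`. Otherwise `two-markings` applies to
    -- the sets with one end of the antipath removed.
    spanned : ∀ {q L} → Spanning T q (suc L) → ConnectedSet (T - q 0) → ConnectedSet (T - q (suc L)) → ⊥
    spanned {q} {L} Q connA connB = cases e refl (parity (suc L)) refl
      where
      open Antipath (s≤s (z≤n {L})) Q
      module R = Antipath (s≤s (z≤n {L})) (reverse-spanning Q)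

      a≢b : q 0 ≢ q (suc L)
      a≢b = distinct z<s ≤-refl

      -- The reversed antipath ends in `q (suc L ∸ suc L)`, which computes only to `q (L ∸ L)`.
      reversed-tail : q (L ∸ L) ≡ q 0
      reversed-tail = cong q (n∸n≡0 L)

      same-sides : e ≡ 1 ⊎ ¬ Odd (suc L) → ⊥
      same-sides cases with Leaf.leaf head∈T tail∈T a≢b connA | Leaf.leaf tail∈T head∈T (a≢b ∘ sym) connB
      ... | inj₁ x | inj₁ y = second a≢b x y
      ... | inj₂ x | inj₂ y = penultimate a≢b x y
      ... | inj₁ x | inj₂ y = opposite cases x y
      ... | inj₂ x | inj₁ y = R.opposite cases y (subst (λ a → AllAdj (T - a) (p (1 + e))) (sym reversed-tail) (λ {z} → x {z}))

      cases : ∀ e′ → e′ ≡ e → ∀ π → parity (suc L) ≡ π → ⊥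
      cases zero refl _ _ = case odd of λ ()
      cases (suc zero) refl _ _ = same-sides (inj₁ refl)
      cases (suc (suc e′)) refl 0ℙ even = same-sides (inj₂ λ odd′ → case trans (sym odd′) even of λ ())
      cases (suc (suc e′)) refl 1ℙ oddL =
        two-markings (λ k → AllAdj? (T - q 0) (p k)) (λ k → AllAdj? (T - q (suc L)) (p k)) (s≤s (s≤s z≤n))
          (λ x∈ → start (x∈p-y⇒x∈p T x∈)) (λ x∈ → start (x∈p-y⇒x∈p T x∈))
          (λ x∈ → end (x∈p-y⇒x∈p T x∈)) (λ x∈ → end (x∈p-y⇒x∈p T x∈))
          (λ k 0<k k< x y → no-clash a≢b 0<k k< x y)
          (gap-free (x∈p⇒p-x⊂p head∈T) connA) (gap-free (x∈p⇒p-x⊂p tail∈T) connB)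
          (mixed (s≤s (s≤s z≤n)) oddL)
          (subst (λ a → OddMixedFree (λ k → AllAdj (T - q (suc L)) (p k)) (λ k → AllAdj (T - a) (p k)) (2 + e))
            reversed-tail (R.mixed (s≤s (s≤s z≤n)) oddL))
          odd

  -- Induction over proper subsets. The step refutes the absence of an outcome, hence the double
  -- negation, which is removed once the alternatives are decidable.
  roussel-rubio : ConnectedSet T → Situation T p e → ¬ ¬ Outcome T p e
  roussel-rubio {T} conn = go T (⊂-wellFounded T) conn
    where
    go : ∀ T → Acc _⊂_ T → ConnectedSet T → ∀ {p e} → Situation T p e → ¬ ¬ Outcome T p e
    go T (acc rec) conn {p} {e} S ¬outcome with Fin.any? (_∈? T)
    -- Every vertex is complete to the empty set, in particular the inner vertex `p 1`.
    ... | no empty = Situation.inner S z≤n λ x∈T → contradiction (_ , x∈T) empty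
    ... | yes (t , t∈T) with Fin.any? (λ x → (x ∈? T) ×-dec ¬? (t Fin.≟ x))
    ...   | yes (x , x∈T , t≢x) = shaped (shape conn t∈T x∈T t≢x)
      where
      open Step T conn p e S ¬outcome (λ {T′} T′⊂T → go T′ (rec T′⊂T))
      shaped : Shape T → ⊥
      shaped (three-noncuts a≢b a≢c b≢c a∈ b∈ c∈ connA connB connC) =
        three-leaves a≢b a≢c b≢c a∈ b∈ c∈ connA connB connC
      shaped (spanning-path Q connA connB) = spanned Q connA connB
    ...   | no alone = singleton-case (λ x∈ y∈ → trans (sym (≡t x∈)) (≡t y∈)) t∈T
      where
      open Step T conn p e S ¬outcome (λ {T′} T′⊂T → go T′ (rec T′⊂T))
      ≡t : ∀ {x} → x ∈ T → t ≡ x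
      ≡t {x} x∈T with t Fin.≟ x
      ... | yes eq = eq
      ... | no t≢x = contradiction (x , x∈T , t≢x) alone

-- Applying the lemma to a long hole.

clamp : ∀ k → ℕ → Fin (suc k)
clamp zero    _       = zero
clamp (suc k) zero    = zero
clamp (suc k) (suc i) = suc (clamp k i)

toℕ-clamp : ∀ {k i} → i ≤ k → toℕ (clamp k i) ≡ i
toℕ-clamp {zero}  z≤n       = refl
toℕ-clamp {suc k} z≤n       = refl
toℕ-clamp {suc k} (s≤s i≤k) = cong suc (toℕ-clamp i≤k)

clamp-toℕ : ∀ {k i} (x : Fin (suc k)) → toℕ x ≡ i → clamp k i ≡ x
clamp-toℕ {k} x refl = Fin.toℕ-injective (toℕ-clamp (s≤s⁻¹ (Fin.toℕ<n x)))

module LongHole {n} (G : Graph (Fin n)) (_~?_ : Decidable (Adj G)) (berge : Berge G)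
                (X : Subset n) (anticonnected : Anticonnected G X)
                {e} (C : Hole G (3 + e)) (C∉X : ∀ i → vertex C i ∉ X) (2≤e : 2 ≤ e)
                (first~ : Complete G X (vertex C zero)) (last~ : Complete G X (vertex C (fromℕ (2 + e))))
                (others : ∀ i → vertex C i ≢ vertex C zero → vertex C i ≢ vertex C (fromℕ (2 + e)) →
                          ¬ Complete G X (vertex C i)) where

  open RousselRubio G _~?_ berge

  first second penultimate last : Fin (3 + e)
  first       = zero
  second      = suc zero
  penultimate = inject₁ (fromℕ (1 + e))
  last        = fromℕ (2 + e)

  HatAt : Fin n → Set
  HatAt x = x ∈ X × x ~ vertex C first × x ~ vertex C last ×
    (∀ i → vertex C i ≢ vertex C first → vertex C i ≢ vertex C last → ¬ x ~ vertex C i)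

  LeapAt : Fin n → Fin n → Set
  LeapAt a b = a ∈ X × b ∈ X × a ≢ b × ¬ a ~ b ×
    NeighboursOn G C a (first ∷ second ∷ last ∷ []) × NeighboursOn G C b (first ∷ penultimate ∷ last ∷ [])

  HatAt? : ∀ x → Dec (HatAt x)
  HatAt? x = (x ∈? X) ×-dec (x ~? _) ×-dec (x ~? _) ×-dec
    Fin.all? λ i → ¬? (_ Fin.≟ _) →-dec (¬? (_ Fin.≟ _) →-dec ¬? (x ~? vertex C i))

  NeighboursOn? : ∀ x is → Dec (NeighboursOn G C x is)
  NeighboursOn? x is = Fin.all? λ i →
    map′ (λ (to , from) → mk⇔ to from) (λ eq → Equivalence.to eq , Equivalence.from eq)
      (((x ~? vertex C i) →-dec (i ∈ˡ? is)) ×-dec ((i ∈ˡ? is) →-dec (x ~? vertex C i)))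
    where open DecList Fin._≟_ renaming (_∈?_ to _∈ˡ?_)

  LeapAt? : ∀ a b → Dec (LeapAt a b)
  LeapAt? a b = (a ∈? X) ×-dec (b ∈? X) ×-dec ¬? (a Fin.≟ b) ×-dec ¬? (a ~? b) ×-dec
    NeighboursOn? a _ ×-dec NeighboursOn? b _

  p : ℕ → Fin n
  p i = vertex C (clamp (2 + e) i)

  p-toℕ : ∀ {i} (x : Fin (3 + e)) → toℕ x ≡ i → p i ≡ vertex C x
  p-toℕ x eq = cong (vertex C) (clamp-toℕ x eq)

  p-last : p (2 + e) ≡ vertex C last
  p-last = p-toℕ last (Fin.toℕ-fromℕ (2 + e))

  p-injective : ∀ {i j} → i ≤ 2 + e → j ≤ 2 + e → p i ≡ p j → i ≡ j
  p-injective i≤ j≤ eq = trans (sym (toℕ-clamp i≤)) (trans (cong toℕ (Hole.injective C eq)) (toℕ-clamp j≤))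

  -- Membership proofs are unique, so distinct vertices of the induced graph lie over distinct
  -- vertices of `G`.
  connected : ConnectedSet X
  connected = record { walk = λ u∈ v∈ →
    Star.gmap proj₁ (λ { {x , x∈} {y , y∈} (x≢y , ¬x~y) →
        x∈ , y∈ , (λ { refl → x≢y (cong (x ,_) ([]=-irrelevant x∈ y∈)) }) , ¬x~y })
      (anticonnected (_ , u∈) (_ , v∈)) }

  -- `e` is odd because the hole has even length `3 + e`. The ends of the path are adjacent, so
  -- `ends` takes its second alternative: a vertex of `X` without inner neighbours would be a hat.
  situation : (∀ x → ¬ HatAt x) → Situation X p e
  situation ¬hat = record
    { odd   = odd
    ; steps = λ {i} i< → Equivalence.from (Hole.adjacency C _ _)
                (inj₁ (inj₁ (trans (toℕ-clamp i<) (cong suc (sym (toℕ-clamp (<⇒≤ i<)))))))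
    ; apart = λ l r proper → (λ eq → <⇒≢ (<-trans (n<1+n _) l) (p-injective (≤-trans (<⇒≤ (<-trans (n<1+n _) l)) r) r eq)) ,
                λ adj → not-cyclic l r proper (Equivalence.to (Hole.adjacency C _ _) adj)
    ; avoid = λ _ → C∉X _
    ; start = first~
    ; end   = subst (λ v → ∀ {x} → x ∈ X → v ~ x) (sym p-last) (λ {x} → last~ {x})
    ; inner = λ i≤e → others _ (p≢first i≤e) (p≢last i≤e)
    ; ends  = inj₂ (2≤e , λ {t} t∈X t≁ → ¬hat t (t∈X , ~-sym (first~ t∈X) , ~-sym (last~ t∈X) ,
                λ i i≢first i≢last → middle i i≢first i≢last λ k≤e eq → subst (λ v → ¬ t ~ v) eq (proj₂ (t≁ k≤e))))
    }
    where
    odd : Odd e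
    odd with parity (suc e) in eq
    ... | 0ℙ = trans (sym (ℙ.suc-homo-⁻¹ e)) (cong ℙ._⁻¹ eq)
    ... | 1ℙ = contradiction eq (2∣⇒¬Odd (proj₁ berge C))

    not-cyclic : ∀ {i j} → suc i < j → j ≤ 2 + e → 0 < i ⊎ j < 2 + e → ¬ CyclicAdj (clamp (2 + e) i) (clamp (2 + e) j)
    not-cyclic {i} {j} l r proper
      rewrite toℕ-clamp {2 + e} {i} (≤-trans (<⇒≤ (<-trans (n<1+n _) l)) r) | toℕ-clamp r = λ
      { (inj₁ (inj₁ refl)) → <-irrefl refl l
      ; (inj₁ (inj₂ (_ , refl))) → contradiction l n≮0
      ; (inj₂ (inj₁ refl)) → <-asym l (s≤s (n≤1+n _))
      ; (inj₂ (inj₂ (refl , refl))) → [ n≮0 , <-irrefl refl ]′ proper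
      }

    p≢first : ∀ {i} → i ≤ e → p (suc i) ≢ vertex C first
    p≢first i≤e eq = case p-injective (s≤s (m≤n⇒m≤1+n i≤e)) z≤n eq of λ ()

    p≢last : ∀ {i} → i ≤ e → p (suc i) ≢ vertex C last
    p≢last i≤e eq = <⇒≢ (s≤s (s≤s i≤e)) (p-injective (s≤s (m≤n⇒m≤1+n i≤e)) ≤-refl (trans eq (sym p-last)))

    middle : ∀ {A : Set} i → vertex C i ≢ vertex C first → vertex C i ≢ vertex C last →
      (∀ {k} → k ≤ e → p (suc k) ≡ vertex C i → A) → A
    middle zero i≢first _ _ = contradiction refl i≢first
    middle (suc i) _ i≢last use with m≤n⇒m<n∨m≡n (s≤s⁻¹ (Fin.toℕ<n i))
    ... | inj₁ (s≤s i≤e) = use i≤e (p-toℕ (suc i) refl)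
    ... | inj₂ eq = contradiction (trans (sym (p-toℕ (suc i) refl)) (trans (cong (p ∘ suc) eq) p-last)) i≢last

  neighbours : ∀ {x} j → x ∈ X → x ~ vertex C j →
    (∀ i → i ≢ first → i ≢ j → i ≢ last → ¬ x ~ vertex C i) → NeighboursOn G C x (first ∷ j ∷ last ∷ [])
  neighbours {x} j x∈X x~j x≁ i = mk⇔ to from
    where
    to : x ~ vertex C i → i List.∈ (first ∷ j ∷ last ∷ [])
    to x~i with i Fin.≟ first | i Fin.≟ j | i Fin.≟ last
    ... | yes eq | _ | _ = here eq
    ... | no _ | yes eq | _ = there (here eq)
    ... | no _ | no _ | yes eq = there (there (here eq))
    ... | no i≢first | no i≢j | no i≢last = contradiction x~i (x≁ i i≢first i≢j i≢last)
    from : i List.∈ (first ∷ j ∷ last ∷ []) → x ~ vertex C i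
    from (here refl) = ~-sym (first~ x∈X)
    from (there (here refl)) = x~j
    from (there (there (here refl))) = ~-sym (last~ x∈X)

  below-last : ∀ (i : Fin (3 + e)) → i ≢ last → toℕ i ≤ 1 + e
  below-last i i≢last = s≤s⁻¹ (≤∧≢⇒< (s≤s⁻¹ (Fin.toℕ<n i))
    λ eq → i≢last (Fin.toℕ-injective (trans eq (sym (Fin.toℕ-fromℕ (2 + e))))))

  toℕ-penultimate : toℕ penultimate ≡ 1 + e
  toℕ-penultimate = trans (Fin.toℕ-inject₁ (fromℕ (1 + e))) (Fin.toℕ-fromℕ (1 + e))

  -- The antipath outcome needs `e = 1`, against `2 ≤ e`. In a leap both vertices see `p 0` and
  -- `p (2 + e)`, these being complete to `X`.
  outcome⇒leap : Outcome X p e → ∃[ a ] ∃[ b ] LeapAt a b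
  outcome⇒leap (antipath e≡1 _ _ _ _ _ _ _) = contradiction (subst (2 ≤_) e≡1 2≤e) λ { (s≤s ()) }
  outcome⇒leap (leap {a} {b} a∈X b∈X (a≢b , ¬a~b) a~ a≁ b~ b≁) = a , b , a∈X , b∈X , a≢b , ¬a~b ,
    neighbours second a∈X a~ away-a ,
    neighbours penultimate b∈X (subst (b ~_) (p-toℕ penultimate toℕ-penultimate) b~) away-b
    where
    away-a : ∀ i → i ≢ first → i ≢ second → i ≢ last → ¬ a ~ vertex C i
    away-a zero i≢first _ _ = contradiction refl i≢first
    away-a (suc zero) _ i≢second _ = contradiction refl i≢second
    away-a i@(suc (suc _)) _ _ i≢last =
      subst (λ v → ¬ a ~ v) (p-toℕ i refl) (proj₂ (a≁ (s≤s⁻¹ (below-last i i≢last))))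
    away-b : ∀ i → i ≢ first → i ≢ penultimate → i ≢ last → ¬ b ~ vertex C i
    away-b zero i≢first _ _ = contradiction refl i≢first
    away-b i@(suc _) _ i≢pen i≢last =
      subst (λ v → ¬ b ~ v) (p-toℕ i refl) (proj₂ (b≁ (s≤s⁻¹ (≤∧≢⇒< (below-last i i≢last)
        λ eq → i≢pen (Fin.toℕ-injective (trans eq (sym toℕ-penultimate)))))))

  -- Both alternatives are decidable by finite search, which discharges the double negation in
  -- `roussel-rubio`.
  hat-or-leap : (∃[ x ] HatAt x) ⊎ (∃[ a ] ∃[ b ] LeapAt a b)
  hat-or-leap with Fin.any? HatAt? | Fin.any? (λ a → Fin.any? (LeapAt? a))
  ... | yes hat | _         = inj₁ hat
  ... | no _    | yes found = inj₂ found
  ... | no ¬hat | no ¬leap =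
    contradiction (¬leap ∘ outcome⇒leap) (roussel-rubio connected (situation λ x hat → ¬hat (x , hat)))

theorem2p10 :
  ∀ {n} (G : Graph (Fin n)) → Decidable (Adj G) → Berge G →
  (X : Subset n) → Anticonnected G X →
  ∀ {m} (C : Hole G (2 + m)) → (∀ i → vertex C i ∉ X) → 4 < 2 + m →
  let first       = zero
      second      = suc zero
      penultimate = inject₁ (fromℕ m)
      last        = fromℕ (1 + m)
  in
  (u v : Fin n) → vertex C first ≡ u → vertex C last ≡ v →
  Complete G X u → Complete G X v →
  (∀ i → vertex C i ≢ u → vertex C i ≢ v → ¬ Complete G X (vertex C i)) →
  (∃[ x ] x ∈ X × Adj G x u × Adj G x v ×
    (∀ i → vertex C i ≢ u → vertex C i ≢ v → ¬ Adj G x (vertex C i)))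
  ⊎
  (∃[ a ] ∃[ b ] a ∈ X × b ∈ X × a ≢ b × ¬ Adj G a b ×
    NeighboursOn G C a (first ∷ second ∷ last ∷ []) ×
    NeighboursOn G C b (first ∷ penultimate ∷ last ∷ []))
-- With `m` as `suc e` the length is `3 + e`, and `5 ≤ 3 + e` reduces to `2 ≤ e`.
theorem2p10 G _~?_ berge X anticonnected {suc e} C C∉X (s≤s (s≤s (s≤s 2≤e))) u v refl refl u~ v~ others =
  LongHole.hat-or-leap G _~?_ berge X anticonnected C C∉X 2≤e u~ v~ others
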